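{- Each of the problems Fully Active Cops and Robber, Cops and Fast Robber, and Surrounding Cops and Robber, on finite, simple, connected graphs $G$, parameterized by the vertex cover number $\mathsf{vcn}$ of $G$, admits a kernel with at most $\mathsf{vcn}+\mathsf{vcn}\cdot 2^{\mathsf{vcn}}$ vertices.
   Context: Cops and Robber game: two players with perfect information play on a graph $G$. The cop player places each of $k$ cops on a vertex (several cops may share a vertex); then the robber player places one robber on a vertex. Then they alternate moves, cops first. In a cop move, each cop either moves to an adjacent vertex or stays; in a robber move, the robber either moves to an adjacent vertex or stays. The cops win if they have a strategy to capture the robber (some cop occupies the same vertex as the robber); the robber wins if it can evade capture indefinitely. Variants: In Fully Active Cops and Robber, in each cop move every cop must move to an adjacent vertex, and in each robber move the robber must move to an adjacent vertex. In Cops and Fast Robber, the robber has a speed $s\in\mathbb{N}$, and in its move it may move along a path with at most $s$ edges containing no cop. In Surrounding Cops and Robber, a cop and the robber may occupy the same vertex, but the robber cannot end its turn by remaining at a vertex occupied by a cop; the cops win by surrounding the robber, i.e. when the robber is at $v$ and there is a cop on every vertex of the open neighbourhood $N(v)$. For each game, the decision problem has as input a graph $G$ and an integer $k\in\mathbb{N}$, and asks whether $k$ cops have a winning strategy. The vertex cover number of $G$ is the minimum size of a set $U\subseteq V(G)$ such that $V(G)\setminus U$ is independent. A kernel for a parameterized problem is (the output of) a polynomial-time algorithm that maps each instance $I$ with parameter value $p$ to an equivalent instance $I'$ of the same problem (i.e. $I$ is a Yes-instance iff $I'$ is) whose size is bounded by a computable function of $p$. "A kernel with at most $f(p)$ vertices"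 means that the graph of $I'$ has at most $f(p)$ vertices, where $p$ is the parameter of the input instance. -}

module Defs where

open import Data.Bool using (Bool; true; false; T)
open import Data.Fin using (Fin)
open import Data.Fin.Subset using (Subset; _∉_; ∣_∣)
open import Data.List using (List; []; _∷_; tabulate)
open import Data.List.Relation.Unary.All using (All)
open import Data.List.Relation.Unary.Unique.Propositional using (Unique)
open import Data.Nat using (ℕ; suc; _+_; _*_; _^_; _≤_)
open import Data.Nat.Binary using (ℕᵇ; 2[1+_]; 1+[2_]; fromℕ)
open import Data.Product using (∃; ∃-syntax; _×_)
open import Function.Bundles using (_⇔_)
open import Relation.Binary.Construct.Closure.Reflexive using (ReflClosure)
open import Relation.Binary.Construct.Closure.ReflexiveTransitive using (Star; ε; _◅_)
open import Relation.Binary.PropositionalEquality using (_≡_; _≢_)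
open import Relation.Nullary using (¬_)

------------------------------------------------------------------------
-- Finite simple graphs

record Graph (n : ℕ) : Set where
  field
    adjacent    : Fin n → Fin n → Bool
    symmetric   : ∀ u v → adjacent u v ≡ adjacent v u
    irreflexive : ∀ v → adjacent v v ≡ false

  Adj : Fin n → Fin n → Set
  Adj u v = T (adjacent u v)

  Walk : Fin n → Fin n → Set
  Walk = Star Adj

  vertices : ∀ {u v} → Walk u v → List (Fin n)
  vertices {u} ε       = u ∷ []
  vertices {u} (_ ◅ w) = u ∷ vertices w

  edges : ∀ {u v} → Walk u v → ℕ
  edges ε       = 0
  edges (_ ◅ w) = suc (edges w)

  IsPath : ∀ {u v} → Walk u v → Set
  IsPath w = Unique (vertices w)

  -- The graph without vertices is connected in this sense.
  Connected : Set
  Connected = ∀ u v → Walk u v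

  IsVertexCover : Subset n → Set
  IsVertexCover U = ∀ {u v} → u ∉ U → v ∉ U → ¬ Adj u v

  IsVertexCoverNumber : ℕ → Set
  IsVertexCoverNumber p =
    (∃[ U ] IsVertexCover U × ∣ U ∣ ≡ p) ×
    (∀ U → IsVertexCover U → p ≤ ∣ U ∣)

------------------------------------------------------------------------
-- Games of k cops against one robber on n vertices

Cops : ℕ → ℕ → Set
Cops n k = Fin k → Fin n

Occupied : ∀ {n k} → Cops n k → Fin n → Set
Occupied c v = ∃[ i ] c i ≡ v

record Rules (n k : ℕ) : Set₁ where
  field
    CopMove    : Fin n → Fin n → Set
    RobberMove : Cops n k → Fin n → Fin n → Set
    CopsGoal   : Cops n k → Fin n → Set

module _ {n k : ℕ} (R : Rules n k) where
  open Rules R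

  -- Winning strategies for the cops as well-founded trees: one move at each of
  -- the cops' turns, a subtree for each legal reply at each of the robber's.
  mutual

    data CopsToMove (c : Cops n k) (r : Fin n) : Set where
      won  : CopsGoal c r → CopsToMove c r
      move : (c′ : Cops n k) → (∀ i → CopMove (c i) (c′ i)) →
             RobberToMove c′ r → CopsToMove c r

    -- A robber who merely has no legal move has not lost; hence the
    -- existence requirement in reply.
    data RobberToMove (c : Cops n k) (r : Fin n) : Set where
      won   : CopsGoal c r → RobberToMove c r
      reply : ∃ (RobberMove c r) →
              (∀ r′ → RobberMove c r r′ → CopsToMove c r′) →
              RobberToMove c r

  CopsWin : Set
  CopsWin = ∃[ c ] ∀ r → CopsToMove c r

module _ {n : ℕ} (G : Graph n) (k : ℕ) where
  open Graph G

  fullyActiveRules : Rules n k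
  fullyActiveRules = record
    { CopMove    = Adj
    ; RobberMove = λ _ → Adj
    ; CopsGoal   = Occupied
    }

  fastRobberRules : ℕ → Rules n k
  fastRobberRules s = record
    { CopMove    = ReflClosure Adj
    ; RobberMove = λ c r r′ → ∃[ w ] IsPath {r} {r′} w × edges w ≤ s ×
                                     All (λ v → ¬ Occupied c v) (vertices w)
    ; CopsGoal   = Occupied
    }

  -- The robber may be placed anywhere, and a cop may enter the robber's vertex,
  -- but after each robber move the robber stands on a vertex without cops.
  surroundingRules : Rules n k
  surroundingRules = record
    { CopMove    = ReflClosure Adj
    ; RobberMove = λ c r r′ → ReflClosure Adj r r′ × ¬ Occupied c r′
    ; CopsGoal   = λ c r → ∀ v → Adj r v → Occupied c v
    }

------------------------------------------------------------------------
-- Decision problems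

record Instance : Set where
  field
    order     : ℕ
    graph     : Graph order
    connected : Graph.Connected graph
    cops      : ℕ

open Instance public

Problem : Set₁
Problem = Instance → Set

FullyActiveCopsAndRobber : Problem
FullyActiveCopsAndRobber I = CopsWin (fullyActiveRules (graph I) (cops I))

CopsAndFastRobber : ℕ → Problem
CopsAndFastRobber s I = CopsWin (fastRobberRules (graph I) (cops I) s)

SurroundingCopsAndRobber : Problem
SurroundingCopsAndRobber I = CopsWin (surroundingRules (graph I) (cops I))

------------------------------------------------------------------------
-- Polynomial time, for while programs with one variable X ranging over binary
-- trees (the language I of N. D. Jones, "Computability and Complexity from a
-- Programming Perspective")

data Tree : Set where
  leaf : Tree
  _∙_  : Tree → Tree → Tree

infixr 5 _∙_

size : Tree → ℕ
size leaf    = 1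
size (a ∙ b) = suc (size a + size b)

data Exp : Set where
  X nil : Exp
  cons  : Exp → Exp → Exp
  hd tl : Exp → Exp

head : Tree → Tree
head leaf    = leaf
head (a ∙ _) = a

tail : Tree → Tree
tail leaf    = leaf
tail (_ ∙ b) = b

eval : Exp → Tree → Tree
eval X          x = x
eval nil        x = leaf
eval (cons e f) x = eval e x ∙ eval f x
eval (hd e)     x = head (eval e x)
eval (tl e)     x = tail (eval e x)

data Cmd : Set where
  X≔_      : Exp → Cmd
  _⨾_      : Cmd → Cmd → Cmd
  while_⟳_ : Exp → Cmd → Cmd

infixr 4 _⨾_
infix  5 X≔_ while_⟳_

-- Run c x y t: started with X = x, the program c halts with X = y in time t.
-- An assignment or test costs the size of the current tree, not one unit: with
-- unit costs, repeating X := cons X X would build a tree of exponential size in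
-- linear time.  With this charge, running times agree with those of Turing
-- machines up to a polynomial.
data Run : Cmd → Tree → Tree → ℕ → Set where
  assign : ∀ {e x} → Run (X≔ e) x (eval e x) (size x)
  seq    : ∀ {c d x y z t u} → Run c x y t → Run d y z u →
           Run (c ⨾ d) x z (t + u)
  exit   : ∀ {e c x} → eval e x ≡ leaf → Run (while e ⟳ c) x x (size x)
  loop   : ∀ {e c x y z t u} → eval e x ≢ leaf → Run c x y t →
           Run (while e ⟳ c) y z u → Run (while e ⟳ c) x z (size x + t + u)

encodeBool : Bool → Tree
encodeBool false = leaf
encodeBool true  = leaf ∙ leaf

encodeList : List Tree → Tree
encodeList []       = leaf
encodeList (x ∷ xs) = x ∙ encodeList xs

encodeBinary : ℕᵇ → Tree
encodeBinary ℕᵇ.zero  = leaf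
encodeBinary 2[1+ b ] = encodeBool true ∙ encodeBinary b
encodeBinary 1+[2 b ] = encodeBool false ∙ encodeBinary b

-- The adjacency matrix together with the number of cops in (bijective) binary.
encode : Instance → Tree
encode I =
  encodeList (tabulate row) ∙ encodeBinary (fromℕ (cops I))
  where
  row : Fin (order I) → Tree
  row u = encodeList (tabulate λ v → encodeBool (Graph.adjacent (graph I) u v))

instanceSize : Instance → ℕ
instanceSize I = size (encode I)

PolynomialTime : (Instance → Instance) → Set
PolynomialTime f =
  ∃[ program ] ∃[ a ] ∃[ d ] ∀ I →
  ∃[ t ] Run program (encode I) (encode (f I)) t × t ≤ a * instanceSize I ^ d

------------------------------------------------------------------------
-- Kernels

Parameter : Set₁
Parameter = Instance → ℕ → Set

vcn : Parameter
vcn I = Graph.IsVertexCoverNumber (graph I)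

-- The algorithm receives the instance only, not the value of the parameter.
-- That the size bound g is computable needs no further condition: every closed
-- function ℕ → ℕ definable here is.
record KernelWithAtMost (f : ℕ → ℕ) (κ : Parameter) (P : Problem) : Set where
  field
    kernel         : Instance → Instance
    polynomialTime : PolynomialTime kernel
    equivalent     : ∀ I → P I ⇔ P (kernel I)
    sizeBound      : ∃ λ (g : ℕ → ℕ) → ∀ I p → κ I p → instanceSize (kernel I) ≤ g p
    orderBound     : ∀ I p → κ I p → order (kernel I) ≤ f p

{-# OPTIONS --safe #-}

-- Vertices with the same neighbourhood (false twins) are interchangeable, so the kernel keeps only a bounded number of
-- vertices of each class of twins.  Vertices outside a vertex cover U of size p fall into at most 2 ^ p classes, one per
-- subset of U, so it suffices to keep at most p vertices of each of these classes, although p is not known.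
--
-- With k cops and at least k + 1 remaining vertices in every class that loses vertices, some twin is always free to stand
-- in for a deleted vertex; this covers the fully active and the fast game as long as k < p.  To recognise the other case,
-- thin out an edge cover to a minimal one.  It is a spanning forest of stars; the centres dominate the graph, so
-- that as many cops win at once, and their number is at most p, because the stars contain disjoint edges.
--
-- In the surrounding game it suffices, whatever k, that a class which loses vertices retains as many as the degree d of
-- its members, and d ≤ p outside U.  If a robber enters the class and finds no free twin to stand in for its position,
-- then d cops occupy twins of that position; they move onto its d neighbours and surround it.
module Submission where

open import Defs
open import Data.Bool using (Bool; true; false; T; not; _∧_; _∨_; if_then_else_)
import Data.Bool.Properties as Bool
open import Data.Bool.Properties using (T?)
open import Data.Empty using (⊥-elim)
open import Data.Fin using (Fin; toℕ; inject≤; join; combine; funToFin; finToFun)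
import Data.Fin as Fin
open import Data.Fin.Properties
  using (toℕ-injective; toℕ<n; any?; injective⇒≤; toℕ-inject≤; inject≤-injective; splitAt-join; join-splitAt;
         combine-injective; finToFun-funToFin)
open import Data.Fin.Subset using (Subset; _∈_; _∉_; ∣_∣; inside; outside)
import Data.Fin.Subset.Properties as Subset
open import Data.List
  using (List; []; _∷_; length; map; filter; drop; take; tabulate; allFin; lookup; foldr; null; replicate;
         reverse; _ʳ++_)
open import Data.List.Membership.Propositional using (find; lose) renaming (_∈_ to _∈ˡ_; _∉_ to _∉ˡ_)
open import Data.List.Membership.Propositional.Properties
  using (∈-filter⁺; ∈-filter⁻; ∈-lookup; ∈-allFin; ∈-++⁻)
open import Data.List.Properties
  using (drop-[]; drop-drop; filter-≐; length-drop; length-replicate; length-tabulate; length-take; map-cong; map-id; map-tabulate;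
         map-∘; reverse-involutive; tabulate-cong; tabulate-lookup; take++drop≡id)
open import Data.List.Relation.Unary.All as All using (All; []; _∷_)
import Data.List.Relation.Unary.All.Properties as All
open import Data.List.Relation.Unary.AllPairs using ([]; _∷_)
open import Data.List.Relation.Unary.Any as Any using (Any; here; there)
open import Data.List.Relation.Unary.Any.Properties using (lookup-index)
open import Data.List.Relation.Unary.Unique.Propositional using (Unique)
import Data.List.Relation.Unary.Unique.Propositional.Properties as Unique
open import Data.List.Relation.Unary.Unique.Propositional.Properties using (filter⁺; allFin⁺)
open import Data.Nat using (ℕ; zero; suc; _+_; _*_; _^_; _∸_; _≤_; _<_; z≤n; s≤s; _≤?_)
import Data.Nat.Binary as Bin
open import Data.Nat.Binary using (ℕᵇ; 2[1+_]; 1+[2_]; fromℕ)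
open import Data.Nat.Binary.Properties using (toℕ-fromℕ)
open import Data.Nat.Properties
open import Data.Nat.Solver using (module +-*-Solver)
open import Data.Product using (Σ; ∃; ∃-syntax; _×_; _,_; proj₁; proj₂)
open import Data.Sum as Sum using (_⊎_; inj₁; inj₂; [_,_]′)
open import Data.Sum.Properties using (inj₁-injective; inj₂-injective)
open import Data.Vec using ([]; _∷_; here; there)
open import Function using (_∘_; id; mk⇔)
open import Function.Bundles using (_⇔_)
open import Function.Definitions using (Injective)
open import Relation.Binary.Construct.Closure.Reflexive using (ReflClosure; [_]) renaming (refl to stay)
open import Relation.Binary.Construct.Closure.ReflexiveTransitive using (ε; _◅_; gmap)
open import Relation.Binary.PropositionalEquality
  using (_≡_; _≢_; _≗_; refl; sym; trans; cong; cong₂; subst)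
open import Relation.Nullary using (¬_; Dec; does; yes; no; ¬?; contradiction)
open import Relation.Nullary.Decidable
  using (decidable-stable; dec-true; dec-false; does-⇔; map′; _×-dec_; _⊎-dec_)

-- Polynomial time

-- The vertex cover number is hard to compute, so each threshold must be read off the instance: the
-- number of cops, which serves only while it is below p, or a degree. The endpoints of a maximal
-- matching would dominate too, but they may number 2p. A minimal edge cover gives p itself: with s
-- edges on n vertices it has n - s stars, one edge from each star forms a matching, and one cop per
-- star dominates. In the surrounding game domination decides nothing, so there the threshold cannot
-- depend on the number of cops. The number of cops also contributes to the size of an instance. A
-- kernel must bound it as well, which is a second reason to replace instances with many cops by
-- constant ones. Polynomial time is shown for explicit while programs. They are assembled by
-- combinators that carry a cost bound along with correctness, so that the program for a reduction
-- follows its definition.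

data Poly : Set where
  var     : Poly
  con     : ℕ → Poly
  _⊕_ _⊗_ : Poly → Poly → Poly

infixl 6 _⊕_
infixl 7 _⊗_

⟦_⟧ : Poly → ℕ → ℕ
⟦ var ⟧ n   = n
⟦ con c ⟧ n = c
⟦ p ⊕ q ⟧ n = ⟦ p ⟧ n + ⟦ q ⟧ n
⟦ p ⊗ q ⟧ n = ⟦ p ⟧ n * ⟦ q ⟧ n

infixl 8 _⊚_

_⊚_ : Poly → Poly → Poly
var ⊚ q      = q
con c ⊚ q    = con c
(p ⊕ p′) ⊚ q = (p ⊚ q) ⊕ (p′ ⊚ q)
(p ⊗ p′) ⊚ q = (p ⊚ q) ⊗ (p′ ⊚ q)

⟦⟧-⊚ : ∀ p q n → ⟦ p ⊚ q ⟧ n ≡ ⟦ p ⟧ (⟦ q ⟧ n)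
⟦⟧-⊚ var q n      = refl
⟦⟧-⊚ (con c) q n  = refl
⟦⟧-⊚ (p ⊕ p′) q n = cong₂ _+_ (⟦⟧-⊚ p q n) (⟦⟧-⊚ p′ q n)
⟦⟧-⊚ (p ⊗ p′) q n = cong₂ _*_ (⟦⟧-⊚ p q n) (⟦⟧-⊚ p′ q n)

⟦⟧-mono : ∀ p {m n} → m ≤ n → ⟦ p ⟧ m ≤ ⟦ p ⟧ n
⟦⟧-mono var m≤n     = m≤n
⟦⟧-mono (con c) m≤n = ≤-refl
⟦⟧-mono (p ⊕ q) m≤n = +-mono-≤ (⟦⟧-mono p m≤n) (⟦⟧-mono q m≤n)
⟦⟧-mono (p ⊗ q) m≤n = *-mono-≤ (⟦⟧-mono p m≤n) (⟦⟧-mono q m≤n)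

≤-⊚ : ∀ p q {m} n → m ≤ ⟦ q ⟧ n → ⟦ p ⟧ m ≤ ⟦ p ⊚ q ⟧ n
≤-⊚ p q n m≤ = ≤-trans (⟦⟧-mono p m≤) (≤-reflexive (sym (⟦⟧-⊚ p q n)))

^-monoʳ : ∀ {n d e} → 1 ≤ n → d ≤ e → n ^ d ≤ n ^ e
^-monoʳ {suc n} _ d≤e = ^-monoʳ-≤ (suc n) d≤e

-- Bounds stay syntactic up to this point, because syntax makes monotonicity and composition
-- structural inductions; `PolynomialTime` wants a single monomial. For `1 ≤ n` powers grow with the
-- exponent, so both exponents of a sum can be raised to `d + e`.
⟦⟧-monomial : ∀ p → ∃[ a ] ∃[ d ] ∀ n → 1 ≤ n → ⟦ p ⟧ n ≤ a * n ^ d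
⟦⟧-monomial var     = 1 , 1 , λ n _ → ≤-reflexive (sym (trans (*-identityˡ (n * 1)) (*-identityʳ n)))
⟦⟧-monomial (con c) = c , 0 , λ n _ → ≤-reflexive (sym (*-identityʳ c))
⟦⟧-monomial (p ⊕ q) with ⟦⟧-monomial p | ⟦⟧-monomial q
... | a , d , p≤ | b , e , q≤ = a + b , d + e , λ n 1≤n → begin
  ⟦ p ⟧ n + ⟦ q ⟧ n                ≤⟨ +-mono-≤ (p≤ n 1≤n) (q≤ n 1≤n) ⟩
  a * n ^ d + b * n ^ e             ≤⟨ +-mono-≤ (*-monoʳ-≤ a (^-monoʳ 1≤n (m≤m+n d e)))
                                                (*-monoʳ-≤ b (^-monoʳ 1≤n (m≤n+m e d))) ⟩
  a * n ^ (d + e) + b * n ^ (d + e) ≡⟨ *-distribʳ-+ (n ^ (d + e)) a b ⟨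
  (a + b) * n ^ (d + e)             ∎
  where open ≤-Reasoning
⟦⟧-monomial (p ⊗ q) with ⟦⟧-monomial p | ⟦⟧-monomial q
... | a , d , p≤ | b , e , q≤ = a * b , d + e , λ n 1≤n → begin
  ⟦ p ⟧ n * ⟦ q ⟧ n           ≤⟨ *-mono-≤ (p≤ n 1≤n) (q≤ n 1≤n) ⟩
  a * n ^ d * (b * n ^ e)     ≡⟨ [m*n]*[o*p]≡[m*o]*[n*p] a (n ^ d) b (n ^ e) ⟩
  a * b * (n ^ d * n ^ e)     ≡⟨ cong (a * b *_) (^-distribˡ-+-* n d e) ⟨
  a * b * n ^ (d + e)         ∎
  where open ≤-Reasoning

1≤size : ∀ x → 1 ≤ size x
1≤size leaf    = ≤-refl
1≤size (_ ∙ _) = s≤s z≤n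

size-head : ∀ x → size (head x) ≤ size x
size-head leaf    = ≤-refl
size-head (a ∙ b) = m≤n⇒m≤1+n (m≤m+n _ _)

size-tail : ∀ x → size (tail x) ≤ size x
size-tail leaf    = ≤-refl
size-tail (a ∙ b) = m≤n⇒m≤1+n (m≤n+m _ _)

expGrowth : Exp → ℕ
expGrowth X          = 1
expGrowth nil        = 1
expGrowth (cons e f) = 1 + (expGrowth e + expGrowth f)
expGrowth (hd e)     = expGrowth e
expGrowth (tl e)     = expGrowth e

size-eval : ∀ e x → size (eval e x) ≤ expGrowth e * size x
size-eval X x          = ≤-reflexive (sym (*-identityˡ _))
size-eval nil x        = ≤-trans (1≤size x) (≤-reflexive (sym (*-identityˡ _)))
size-eval (cons e f) x = begin
  1 + (size (eval e x) + size (eval f x))                ≤⟨ +-mono-≤ (1≤size x) (+-mono-≤ (size-eval e x) (size-eval f x)) ⟩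
  size x + (expGrowth e * size x + expGrowth f * size x)
    ≡⟨ cong (size x +_) (*-distribʳ-+ (size x) (expGrowth e) (expGrowth f)) ⟨
  size x + (expGrowth e + expGrowth f) * size x          ∎
  where open ≤-Reasoning
size-eval (hd e) x     = ≤-trans (size-head (eval e x)) (size-eval e x)
size-eval (tl e) x     = ≤-trans (size-tail (eval e x)) (size-eval e x)

growth : Cmd → ℕ
growth (X≔ e)      = expGrowth e
growth (c ⨾ d)     = growth d
growth (while _ ⟳ _) = 1

-- The last step of a run is an assignment or a failed test, and it is charged the size of the tree
-- that it reads. So time bounds the size of the output up to a constant factor, and sequential
-- composition needs time bounds only.
size-run : ∀ {c x y t} → Run c x y t → size y ≤ growth c * t
size-run (assign {e} {x})   = size-eval e x
size-run (seq {d = d} {t = t} r r′) = ≤-trans (size-run r′) (*-monoʳ-≤ (growth d) (m≤n+m _ t))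
size-run (exit _)           = ≤-reflexive (sym (*-identityˡ _))
size-run (loop {x = x} {t = t} _ _ r) = ≤-trans (size-run r) (*-monoʳ-≤ 1 (m≤n+m _ (size x + t)))

-- The program sends e γ, the code of a context γ, to the code of v γ.  Contexts may be of any type, so that indexed
-- families such as the vertices of a given graph need no total decoding of trees.
record Computes {Γ : Set} (e : Γ → Tree) {B : Γ → Set}
                (enc : ∀ γ → B γ → Tree) (v : ∀ γ → B γ) : Set where
  constructor computes
  field
    program : Cmd
    bound   : Poly
    run     : ∀ γ → ∃[ t ] Run program (e γ) (enc γ (v γ)) t × t ≤ ⟦ bound ⟧ (size (e γ))

open Computes

infix 3 _⇝_

_⇝_ : {Γ : Set} → (Γ → Tree) → (Γ → Tree) → Set
e ⇝ h = Computes e (λ _ → id) h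

-- A program sees only codes, so its specification can be exchanged for any other with the same
-- codes.
recode : ∀ {Γ : Set} {e : Γ → Tree} {B B′ : Γ → Set} {enc : ∀ γ → B γ → Tree} {enc′ : ∀ γ → B′ γ → Tree}
         {v v′} → (∀ γ → enc γ (v γ) ≡ enc′ γ (v′ γ)) → Computes e enc v → Computes e enc′ v′
recode eq c = computes (program c) (bound c) λ γ →
  let t , r , t≤ = run c γ in t , subst (λ y → Run _ _ y t) (eq γ) r , t≤

restrict : ∀ {Γ Δ : Set} (f : Δ → Γ) {e : Γ → Tree} {B : Γ → Set} {enc : ∀ γ → B γ → Tree} {v} →
           Computes e enc v → Computes (e ∘ f) (λ δ → enc (f δ)) (v ∘ f)
restrict f c = computes (program c) (bound c) (run c ∘ f)

module _ {Γ : Set} {e : Γ → Tree} where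

  outBound : {B : Γ → Set} {enc : ∀ γ → B γ → Tree} {v : ∀ γ → B γ} → Computes e enc v → Poly
  outBound c = con (growth (program c)) ⊗ bound c

  size-out : {B : Γ → Set} {enc : ∀ γ → B γ → Tree} {v : ∀ γ → B γ} (c : Computes e enc v) →
             ∀ γ → size (enc γ (v γ)) ≤ ⟦ outBound c ⟧ (size (e γ))
  size-out c γ = let t , r , t≤ = run c γ in ≤-trans (size-run r) (*-monoʳ-≤ (growth (program c)) t≤)

  infixl 5 _then_

  _then_ : {h : Γ → Tree} {B : Γ → Set} {enc : ∀ γ → B γ → Tree} {v : ∀ γ → B γ} →
           e ⇝ h → Computes h enc v → Computes e enc v
  c then d = computes (program c ⨾ program d) (bound c ⊕ bound d ⊚ outBound c) λ γ →
    let t , r , t≤ = run c γ ; u , s , u≤ = run d γ in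
    t + u , seq r s , +-mono-≤ t≤ (≤-trans u≤ (≤-⊚ (bound d) (outBound c) _ (size-out c γ)))

  expC : (ex : Exp) → e ⇝ (λ γ → eval ex (e γ))
  expC ex = computes (X≔ ex) var λ γ → _ , assign , ≤-refl

  raw : {B : Γ → Set} {enc : ∀ γ → B γ → Tree} {v : ∀ γ → B γ} → Computes e enc v → e ⇝ (λ γ → enc γ (v γ))
  raw = recode (λ _ → refl)

-- Saving a context while a program runs, and branching

onHeadᵉ : Exp → Exp
onHeadᵉ X          = hd X
onHeadᵉ nil        = nil
onHeadᵉ (cons e f) = cons (onHeadᵉ e) (onHeadᵉ f)
onHeadᵉ (hd e)     = hd (onHeadᵉ e)
onHeadᵉ (tl e)     = tl (onHeadᵉ e)

-- With a single variable, a context survives a subprogram only as part of the same tree. The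
-- subprogram is therefore rewritten to work on the left component of a pair and to leave the right
-- one alone.
onHead : Cmd → Cmd
onHead (X≔ e)        = X≔ cons (onHeadᵉ e) (tl X)
onHead (c ⨾ d)       = onHead c ⨾ onHead d
onHead (while e ⟳ c) = while onHeadᵉ e ⟳ onHead c

eval-onHeadᵉ : ∀ e x z → eval (onHeadᵉ e) (x ∙ z) ≡ eval e x
eval-onHeadᵉ X x z          = refl
eval-onHeadᵉ nil x z        = refl
eval-onHeadᵉ (cons e f) x z = cong₂ _∙_ (eval-onHeadᵉ e x z) (eval-onHeadᵉ f x z)
eval-onHeadᵉ (hd e) x z     = cong head (eval-onHeadᵉ e x z)
eval-onHeadᵉ (tl e) x z     = cong tail (eval-onHeadᵉ e x z)

size-∙≤ : ∀ x z → size (x ∙ z) ≤ size x * (2 + size z)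
size-∙≤ x z = begin
  1 + (size x + size z)               ≤⟨ +-monoˡ-≤ _ (1≤size x) ⟩
  size x + (size x + size z)          ≤⟨ +-monoʳ-≤ (size x) (+-monoʳ-≤ (size x) (m≤n*m′ (size z) (1≤size x))) ⟩
  size x + (size x + size x * size z) ≡⟨ cong (size x +_) (*-suc (size x) (size z)) ⟨
  size x + size x * suc (size z)      ≡⟨ *-suc (size x) (suc (size z)) ⟨
  size x * (2 + size z)               ∎
  where
  open ≤-Reasoning
  m≤n*m′ : ∀ m {n} → 1 ≤ n → m ≤ n * m
  m≤n*m′ m {suc n} _ = m≤m+n m (n * m)

-- Each step costs at least one unit, so that carrying z along multiplies the cost by at most 2 + size z.
run-onHead : ∀ {c x y t} z → Run c x y t →
             ∃[ t′ ] Run (onHead c) (x ∙ z) (y ∙ z) t′ × t′ ≤ t * (2 + size z)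
run-onHead z (assign {e} {x}) =
  _ , subst (λ y → Run (X≔ cons (onHeadᵉ e) (tl X)) (x ∙ z) (y ∙ z) (size (x ∙ z))) (eval-onHeadᵉ e x z) assign , size-∙≤ x z
run-onHead z (seq {t = t} {u} r s) =
  let t′ , r′ , t≤ = run-onHead z r ; u′ , s′ , u≤ = run-onHead z s in
  t′ + u′ , seq r′ s′ , ≤-trans (+-mono-≤ t≤ u≤) (≤-reflexive (sym (*-distribʳ-+ (2 + size z) t u)))
run-onHead z (exit {e} {x = x} eq) = _ , exit (trans (eval-onHeadᵉ e x z) eq) , size-∙≤ x z
run-onHead z (loop {e} {x = x} {t = t} {u} ne r s) =
  let t′ , r′ , t≤ = run-onHead z r ; u′ , s′ , u≤ = run-onHead z s in
  _ , loop (ne ∘ trans (sym (eval-onHeadᵉ e x z))) r′ s′ , (begin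
    size (x ∙ z) + t′ + u′ ≤⟨ +-mono-≤ (+-mono-≤ (size-∙≤ x z) t≤) u≤ ⟩
    size x * (2 + size z) + t * (2 + size z) + u * (2 + size z)
      ≡⟨ cong (_+ u * (2 + size z)) (*-distribʳ-+ (2 + size z) (size x) t) ⟨
    (size x + t) * (2 + size z) + u * (2 + size z) ≡⟨ *-distribʳ-+ (2 + size z) (size x + t) u ⟨
    (size x + t + u) * (2 + size z) ∎)
  where open ≤-Reasoning

module _ {Γ : Set} where

  onHeadC : {e h : Γ → Tree} (z : Γ → Tree) → e ⇝ h → (λ γ → e γ ∙ z γ) ⇝ (λ γ → h γ ∙ z γ)
  onHeadC {e} z c = computes (onHead (program c)) (bound c ⊗ (con 2 ⊕ var)) λ γ →
    let t , r , t≤ = run c γ ; t′ , r′ , t′≤ = run-onHead (z γ) r in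
    t′ , r′ , ≤-trans t′≤ (*-mono-≤
      (≤-trans t≤ (⟦⟧-mono (bound c) (m≤n⇒m≤1+n (m≤m+n _ _))))
      (+-monoʳ-≤ 2 (m≤n⇒m≤1+n (m≤n+m _ (size (e γ))))))

  pairC : {e : Γ → Tree} {A B : Γ → Set} {encA : ∀ γ → A γ → Tree} {encB : ∀ γ → B γ → Tree} {a : ∀ γ → A γ} {b : ∀ γ → B γ} →
          Computes e encA a → Computes e encB b → e ⇝ (λ γ → encA γ (a γ) ∙ encB γ (b γ))
  pairC c d = expC (cons X X) then onHeadC _ (raw c) then expC (cons (tl X) (hd X))
              then onHeadC _ (raw d) then expC (cons (tl X) (hd X))

  constC : {e : Γ → Tree} (ex : Exp) (t : Tree) → (∀ x → eval ex x ≡ t) → e ⇝ (λ _ → t)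
  constC ex _ eq = recode (λ γ → eq _) (expC ex)

  -- The loop runs at most once, since its body clears the flag at the head.
  whenC : {z w : Γ → Tree} (b : Γ → Bool) →
          Computes {Σ Γ (λ γ → b γ ≡ true)} (z ∘ proj₁) (λ _ → id) (w ∘ proj₁) →
          (λ γ → encodeBool (b γ) ∙ z γ) ⇝ (λ γ → leaf ∙ (if b γ then w γ else z γ))
  whenC {z} {w} b c = computes (while hd X ⟳ (X≔ tl X ⨾ program c ⨾ X≔ cons nil X))
    time λ γ → go γ (b γ) refl
    where
    W    = outBound c
    time = var ⊕ (var ⊕ (bound c ⊕ W)) ⊕ (con 2 ⊕ W)
    go : ∀ γ b′ → b γ ≡ b′ → ∃[ t ] Run _ (encodeBool b′ ∙ z γ) (leaf ∙ (if b′ then w γ else z γ)) t ×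
                                     t ≤ ⟦ time ⟧ (size (encodeBool b′ ∙ z γ))
    go γ false eq = _ , exit refl , ≤-trans (m≤m+n _ _) (m≤m+n _ _)
    go γ true eq  =
      let t , r , t≤ = run c (γ , eq)
          z≤ = m≤n⇒m≤1+n (m≤n+m (size (z γ)) 3)
          w≤ = ≤-trans (size-out c (γ , eq)) (⟦⟧-mono W z≤)
          n  = size (encodeBool true ∙ z γ)
      in _ , loop (λ ()) (seq assign (seq r assign)) (exit refl) ,
         +-mono-≤ (+-monoʳ-≤ n (+-monoʳ-≤ n (+-mono-≤ (≤-trans t≤ (⟦⟧-mono (bound c) z≤)) w≤)))
                  (s≤s (s≤s w≤))

not-true : ∀ b → not b ≡ true → b ≡ false
not-true false _ = refl

module _ {Γ : Set} {e : Γ → Tree} {B : Γ → Set} {enc : ∀ γ → B γ → Tree} {b : Γ → Bool} {v w : ∀ γ → B γ} where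

  -- The language has loops but no conditional. A second flag, initially true, lies behind the first
  -- one; the then-branch clears it, so that it guards the else-branch and exactly one of the two is
  -- run.
  ifC : Computes e (λ _ → encodeBool) b → Computes e enc v → Computes e enc w →
        Computes e enc (λ γ → if b γ then v γ else w γ)
  ifC cb cv cw = recode (λ γ → final (b γ))
    (pairC cb (pairC (constC (cons nil nil) (encodeBool true) (λ _ → refl)) (expC X))
     then whenC {w = λ γ → leaf ∙ enc γ (v γ)} b
       (restrict proj₁ (expC (tl X) then raw cv then expC (cons nil X)))
     then recode (λ γ → middle (b γ)) (expC (tl X))
     then whenC {z = λ γ → if b γ then enc γ (v γ) else e γ} {w = λ γ → enc γ (w γ)} (not ∘ b)
       (computes (program cw) (bound cw) λ { (γ , eq) →
          subst (λ b′ → ∃[ t ] Run (program cw) (if b′ then enc γ (v γ) else e γ) (enc γ (w γ)) t ×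
                                t ≤ ⟦ bound cw ⟧ (size (if b′ then enc γ (v γ) else e γ)))
                (sym (not-true (b γ) eq)) (run cw γ) })
     then expC (tl X))
    where
    middle : ∀ b {x y} → (if b then leaf ∙ x else encodeBool true ∙ y) ≡ encodeBool (not b) ∙ (if b then x else y)
    middle true  = refl
    middle false = refl
    final : ∀ b {γ x y z} → (if not b then enc γ y else (if b then enc γ x else z)) ≡ enc γ (if b then x else y)
    final true  = refl
    final false = refl

-- Loops over lists

encL : {A : Set} → (A → Tree) → List A → Tree
encL enc xs = encodeList (map enc xs)

length≤size : {A : Set} (enc : A → Tree) (xs : List A) → length xs ≤ size (encL enc xs)
length≤size enc []       = z≤n
length≤size enc (x ∷ xs) = s≤s (≤-trans (length≤size enc xs) (m≤n+m _ _))

size-move : {A : Set} (enc : A → Tree) (a : A) (xs ys : List A) →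
            size (encL enc (a ∷ xs)) + size (encL enc ys) ≡ size (encL enc xs) + size (encL enc (a ∷ ys))
size-move enc a xs ys = solve 3 (λ a x y → (con 1 :+ (a :+ x)) :+ y := x :+ (con 1 :+ (a :+ y))) refl
                                (size (enc a)) (size (encL enc xs)) (size (encL enc ys))
  where open +-*-Solver

size-ʳ++ : {A : Set} (enc : A → Tree) (xs ys : List A) →
           suc (size (encL enc (xs ʳ++ ys))) ≡ size (encL enc xs) + size (encL enc ys)
size-ʳ++ enc [] ys       = refl
size-ʳ++ enc (x ∷ xs) ys = trans (size-ʳ++ enc xs (x ∷ ys)) (sym (size-move enc x xs ys))

size-reverse : {A : Set} (enc : A → Tree) (xs : List A) → size (encL enc (reverse xs)) ≡ size (encL enc xs)
size-reverse enc xs = suc-injective (trans (size-ʳ++ enc xs []) (+-comm _ 1))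

size-filter : ∀ {A : Set} (enc : A → Tree) {P : A → Set} (P? : ∀ a → Dec (P a)) xs →
              size (encL enc (filter P? xs)) ≤ size (encL enc xs)
size-filter enc P? [] = ≤-refl
size-filter enc P? (x ∷ xs) with does (P? x)
... | true  = s≤s (+-monoʳ-≤ (size (enc x)) (size-filter enc P? xs))
... | false = ≤-trans (size-filter enc P? xs) (m≤n⇒m≤1+n (m≤n+m _ _))

module _ {Γ : Set} {e : Γ → Tree} {A : Γ → Set} {encA : ∀ γ → A γ → Tree} {xs : ∀ γ → List (A γ)}
         (g : ∀ γ → List (A γ) → Tree) (Q : Poly) where

  private
    state : ∀ γ → List (A γ) → List (A γ) → Tree
    state γ rest as = encL (encA γ) rest ∙ (g γ as ∙ e γ)

  -- The state holds the rest of the list, the accumulator and the context. Even a fast body could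
  -- build an exponentially large accumulator when iterated, hence the last hypothesis, which bounds
  -- every accumulator in advance. Elements are consumed from the front, so the accumulator sees
  -- them in reverse.
  foldlC : Computes e (λ γ → encL (encA γ)) xs →
           e ⇝ (λ γ → g γ []) →
           (λ ((γ , a , as) : Σ Γ (λ γ → A γ × List (A γ))) → encA γ a ∙ (g γ as ∙ e γ)) ⇝ (λ (γ , a , as) → g γ (a ∷ as)) →
           (∀ γ as → size (encL (encA γ) as) ≤ size (encL (encA γ) (xs γ)) → size (g γ as) ≤ ⟦ Q ⟧ (size (e γ))) →
           e ⇝ (λ γ → g γ (reverse (xs γ)))
  foldlC cxs base step g≤ = pairC cxs (pairC base (expC X)) then loopC then expC (hd (tl X))
    where
    Δ : Set
    Δ = Σ Γ (λ γ → A γ × List (A γ) × List (A γ))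

    body : _⇝_ {Δ} (λ (γ , a , rest , as) → state γ (a ∷ rest) as) (λ (γ , a , rest , as) → state γ rest (a ∷ as))
    body = pairC (expC (tl (hd X)))
                 (pairC (expC (cons (hd (hd X)) (tl X)) then restrict (λ (γ , a , rest , as) → γ , a , as) step)
                        (expC (tl (tl X))))

    -- `M` bounds the state throughout the loop: `Q` the accumulator, and the size of the initial
    -- state both the rest of the list and the context.
    M time : Poly
    M    = con 1 ⊕ (var ⊕ (con 1 ⊕ (Q ⊕ var)))
    time = var ⊗ (M ⊕ bound body ⊚ M) ⊕ M

    module _ (γ : Γ) where
      n = size (state γ (xs γ) [])

      small : ∀ rest as → size (encL (encA γ) rest) + size (encL (encA γ) as) ≤ suc (size (encL (encA γ) (xs γ))) →
              size (state γ rest as) ≤ ⟦ M ⟧ n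
      small rest as inv = s≤s (+-mono-≤ (≤-trans rest≤ (m≤n⇒m≤1+n (m≤m+n _ _)))
                                        (s≤s (+-mono-≤ (≤-trans (g≤ γ as as≤) (⟦⟧-mono Q e≤)) e≤)))
        where
        e≤ : size (e γ) ≤ n
        e≤ = m≤n⇒m≤1+n (≤-trans (m≤n⇒m≤1+n (m≤n+m _ _)) (m≤n+m _ (size (encL (encA γ) (xs γ)))))
        rest≤ : size (encL (encA γ) rest) ≤ size (encL (encA γ) (xs γ))
        rest≤ = ≤-pred (≤-trans (≤-reflexive (+-comm 1 _)) (≤-trans (+-monoʳ-≤ _ (1≤size (encL (encA γ) as))) inv))
        as≤ : size (encL (encA γ) as) ≤ size (encL (encA γ) (xs γ))
        as≤ = ≤-pred (≤-trans (+-monoˡ-≤ _ (1≤size (encL (encA γ) rest))) inv)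

      -- Moving an element between the two lists preserves the sum of their code sizes. The `suc`
      -- pays for the code of the initially empty list.
      go : ∀ rest as → size (encL (encA γ) rest) + size (encL (encA γ) as) ≤ suc (size (encL (encA γ) (xs γ))) →
           ∃[ t ] Run (while hd X ⟳ program body) (state γ rest as) (state γ [] (rest ʳ++ as)) t ×
                  t ≤ length rest * (⟦ M ⟧ n + ⟦ bound body ⊚ M ⟧ n) + ⟦ M ⟧ n
      go [] as inv = _ , exit refl , small [] as inv
      go (a ∷ rest) as inv =
        let t , r , t≤ = run body (γ , a , rest , as)
            u , s , u≤ = go rest (a ∷ as) (subst (_≤ suc (size (encL (encA γ) (xs γ)))) (size-move (encA γ) a rest as) inv)
        in _ , loop (λ ()) r s , ≤-trans
             (+-mono-≤ (+-mono-≤ (small (a ∷ rest) as inv)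
                                 (≤-trans t≤ (≤-⊚ (bound body) M n (small (a ∷ rest) as inv)))) u≤)
             (≤-reflexive (sym (+-assoc (⟦ M ⟧ n + ⟦ bound body ⊚ M ⟧ n)
                                        (length rest * (⟦ M ⟧ n + ⟦ bound body ⊚ M ⟧ n)) (⟦ M ⟧ n))))

    loopC : (λ γ → state γ (xs γ) []) ⇝ (λ γ → state γ [] (reverse (xs γ)))
    loopC = computes (while hd X ⟳ program body) time λ γ →
      let t , r , t≤ = go γ (xs γ) [] (≤-reflexive (+-comm _ 1)) in
      t , r , ≤-trans t≤ (+-monoˡ-≤ _ (*-monoˡ-≤ _ (≤-trans (length≤size (encA γ) (xs γ)) (m≤n⇒m≤1+n (m≤m+n _ _)))))

module _ {Γ : Set} {e : Γ → Tree} {A : Γ → Set} {encA : ∀ γ → A γ → Tree} {xs : ∀ γ → List (A γ)} where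

  reverseC : Computes e (λ γ → encL (encA γ)) xs → Computes e (λ γ → encL (encA γ)) (λ γ → reverse (xs γ))
  reverseC cxs = recode (λ _ → refl)
    (foldlC (λ γ → encL (encA γ)) (outBound cxs) cxs (expC nil) (expC (cons (hd X) (hd (tl X))))
      (λ γ as as≤ → ≤-trans as≤ (size-out cxs γ)))

  foldrC : (g : ∀ γ → List (A γ) → Tree) (Q : Poly) →
           Computes e (λ γ → encL (encA γ)) xs →
           e ⇝ (λ γ → g γ []) →
           (λ ((γ , a , as) : Σ Γ (λ γ → A γ × List (A γ))) → encA γ a ∙ (g γ as ∙ e γ)) ⇝ (λ (γ , a , as) → g γ (a ∷ as)) →
           (∀ γ as → size (encL (encA γ) as) ≤ size (encL (encA γ) (xs γ)) → size (g γ as) ≤ ⟦ Q ⟧ (size (e γ))) →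
           e ⇝ (λ γ → g γ (xs γ))
  foldrC g Q cxs base step g≤ = recode (λ γ → cong (g γ) (reverse-involutive (xs γ)))
    (foldlC g Q (reverseC cxs) base step
      (λ γ as as≤ → g≤ γ as (≤-trans as≤ (≤-reflexive (size-reverse (encA γ) (xs γ))))))

-- Contexts are nested pairs with the latest variable at the head; `newest` and `weaken` give access
-- to the variables under the binders of `mapC`, `filterC`, `allC` and `anyC`, in the manner of de
-- Bruijn indices.
ext : {Γ : Set} (e : Γ → Tree) {A : Γ → Set} (encA : ∀ γ → A γ → Tree) → Σ Γ A → Tree
ext e encA (γ , a) = encA γ a ∙ e γ

module _ {Γ : Set} {e : Γ → Tree} {A : Γ → Set} {encA : ∀ γ → A γ → Tree} where

  weaken : {B : Γ → Set} {enc : ∀ γ → B γ → Tree} {v : ∀ γ → B γ} →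
           Computes e enc v → Computes (ext e encA) (enc ∘ proj₁) (v ∘ proj₁)
  weaken c = expC (tl X) then restrict proj₁ c

  newest : Computes (ext e encA) (encA ∘ proj₁) proj₂
  newest = recode (λ _ → refl) (expC (hd X))

  module _ {xs : ∀ γ → List (A γ)} (cxs : Computes e (λ γ → encL (encA γ)) xs) where

    mapC : {B : Γ → Set} {encB : ∀ γ → B γ → Tree} {f : ∀ γ → A γ → B γ} →
           Computes (ext e encA) (encB ∘ proj₁) (λ (γ , a) → f γ a) →
           Computes e (λ γ → encL (encB γ)) (λ γ → map (f γ) (xs γ))
    mapC {encB = encB} {f} cf = recode (λ _ → refl)
      (foldrC (λ γ as → encL (encB γ) (map (f γ) as)) (con 1 ⊕ N ⊗ (con 1 ⊕ W)) cxs (expC nil)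
        (pairC (expC (cons (hd X) (tl (tl X))) then restrict (λ (γ , a , as) → γ , a) (raw cf)) (expC (hd (tl X))))
        λ γ as as≤ → ≤-trans (go γ as (≤-trans as≤ (size-out cxs γ)))
          (s≤s (*-monoˡ-≤ _ (≤-trans (≤-trans (length≤size (encA γ) as) as≤) (size-out cxs γ)))))
      where
      N W : Poly
      N = outBound cxs
      W = outBound cf ⊚ (con 1 ⊕ (N ⊕ var))
      go : ∀ γ as → size (encL (encA γ) as) ≤ ⟦ N ⟧ (size (e γ)) →
           size (encL (encB γ) (map (f γ) as)) ≤ 1 + length as * (1 + ⟦ W ⟧ (size (e γ)))
      go γ [] _ = ≤-refl
      go γ (a ∷ as) ≤N = s≤s (≤-trans
        (+-mono-≤ (≤-trans (size-out cf (γ , a)) (≤-⊚ (outBound cf) (con 1 ⊕ (N ⊕ var)) (size (e γ))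
                    (s≤s (+-monoˡ-≤ _ (≤-trans (m≤n⇒m≤1+n (m≤m+n _ _)) ≤N)))))
                  (go γ as (≤-trans (m≤n⇒m≤1+n (m≤n+m _ _)) ≤N)))
        (≤-reflexive (+-suc _ _)))

    filterC : {P : ∀ γ → A γ → Set} {P? : ∀ γ a → Dec (P γ a)} →
              Computes (ext e encA) (λ _ → encodeBool) (λ (γ , a) → does (P? γ a)) →
              Computes e (λ γ → encL (encA γ)) (λ γ → filter (P? γ) (xs γ))
    filterC {P? = P?} cp = recode (λ _ → refl)
      (foldrC (λ γ as → encL (encA γ) (filter (P? γ) as)) (outBound cxs) cxs (expC nil)
        (recode (λ (γ , a , as) → eq γ a as)
          (ifC {enc = λ _ → id} (expC (cons (hd X) (tl (tl X))) then restrict (λ (γ , a , as) → γ , a) cp)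
               (expC (cons (hd X) (hd (tl X))))
               (expC (hd (tl X)))))
        λ γ as as≤ → ≤-trans (≤-trans (size-filter (encA γ) (P? γ) as) as≤) (size-out cxs γ))
      where
      eq : ∀ γ a as → (if does (P? γ a) then encA γ a ∙ encL (encA γ) (filter (P? γ) as) else encL (encA γ) (filter (P? γ) as))
                      ≡ encL (encA γ) (filter (P? γ) (a ∷ as))
      eq γ a as with does (P? γ a)
      ... | true  = refl
      ... | false = refl

-- Unary numbers as lists, tests and comparisons

unary : ℕ → Tree
unary n = encL id (replicate n leaf)

encV : ∀ {n} → Fin n → Tree
encV = unary ∘ toℕ

tails : ℕ → Tree → Tree
tails zero t    = t
tails (suc n) t = tail (tails n t)

tails-tail : ∀ n t → tails n (tail t) ≡ tail (tails n t)
tails-tail zero t    = refl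
tails-tail (suc n) t = cong tail (tails-tail n t)

tails-encodeList : ∀ {A : Set} (enc : A → Tree) n xs → tails n (encL enc xs) ≡ encL enc (drop n xs)
tails-encodeList enc zero xs          = refl
tails-encodeList enc (suc n) []       =
  trans (sym (tails-tail n leaf)) (trans (tails-encodeList enc n []) (cong (encL enc) (drop-[] n)))
tails-encodeList enc (suc n) (x ∷ xs) = trans (sym (tails-tail n (encL enc (x ∷ xs)))) (tails-encodeList enc n xs)

head-tails : ∀ {n} (f : Fin n → Tree) (i : Fin n) → head (tails (toℕ i) (encodeList (tabulate f))) ≡ f i
head-tails f Fin.zero    = refl
head-tails f (Fin.suc i) = trans (cong head (sym (tails-tail (toℕ i) (encodeList (tabulate f))))) (head-tails (f ∘ Fin.suc) i)

size-tails : ∀ n t → size (tails n t) ≤ size t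
size-tails zero t    = ≤-refl
size-tails (suc n) t = ≤-trans (size-tail (tails n t)) (size-tails n t)

drop-replicate : ∀ {A : Set} m n {x : A} → drop n (replicate m x) ≡ replicate (m ∸ n) x
drop-replicate m zero          = refl
drop-replicate zero (suc n)    = refl
drop-replicate (suc m) (suc n) = drop-replicate m n

map-const : ∀ {A B : Set} (b : B) (xs : List A) → map (λ _ → b) xs ≡ replicate (length xs) b
map-const b []       = refl
map-const b (x ∷ xs) = cong (b ∷_) (map-const b xs)

boolC : {Γ : Set} {e : Γ → Tree} (b : Bool) → Computes e (λ _ → encodeBool) (λ _ → b)
boolC true  = recode (λ _ → refl) (expC (cons nil nil))
boolC false = recode (λ _ → refl) (expC nil)

nullC : {Γ : Set} {e : Γ → Tree} {A : Γ → Set} {encA : ∀ γ → A γ → Tree} {xs : ∀ γ → List (A γ)} →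
        Computes e (λ γ → encL (encA γ)) xs → Computes e (λ _ → encodeBool) (λ γ → null (xs γ))
nullC cxs = recode (λ _ → refl)
  (foldrC (λ _ as → encodeBool (null as)) (con 3) cxs (raw (boolC true)) (raw (boolC false)) (λ γ as _ → small (null as)))
  where
  small : ∀ b → size (encodeBool b) ≤ 3
  small true  = ≤-refl
  small false = s≤s z≤n

null-∸ : ∀ m n → null (replicate (m ∸ n) leaf) ≡ does (m ≤? n)
null-∸ m n = does-≡-null (m ∸ n) (m ≤? n) (m≤n⇒m∸n≡0) (m∸n≡0⇒m≤n)
  where
  does-≡-null : ∀ d {P : Set} (P? : Dec P) → (P → d ≡ 0) → (d ≡ 0 → P) → null (replicate d leaf) ≡ does P?
  does-≡-null zero    P? _ f = sym (dec-true P? (f refl))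
  does-≡-null (suc d) P? f _ = sym (dec-false P? λ p → 1+n≢0 (f p))

module _ {Γ : Set} {e : Γ → Tree} where

  notC : {b : Γ → Bool} → Computes e (λ _ → encodeBool) b → Computes e (λ _ → encodeBool) (not ∘ b)
  notC {b} c = recode (λ γ → eq (b γ)) (ifC c (boolC false) (boolC true))
    where
    eq : ∀ b → encodeBool (if b then false else true) ≡ encodeBool (not b)
    eq true  = refl
    eq false = refl

  andC : {b c : Γ → Bool} → Computes e (λ _ → encodeBool) b → Computes e (λ _ → encodeBool) c →
         Computes e (λ _ → encodeBool) (λ γ → b γ ∧ c γ)
  andC {b} {c} cb cc = recode (λ γ → eq (b γ) (c γ)) (ifC cb cc (boolC false))
    where
    eq : ∀ b c → encodeBool (if b then c else false) ≡ encodeBool (b ∧ c)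
    eq true c  = refl
    eq false c = refl

  orC : {b c : Γ → Bool} → Computes e (λ _ → encodeBool) b → Computes e (λ _ → encodeBool) c →
        Computes e (λ _ → encodeBool) (λ γ → b γ ∨ c γ)
  orC {b} {c} cb cc = recode (λ γ → eq (b γ) (c γ)) (ifC cb (boolC true) cc)
    where
    eq : ∀ b c → encodeBool (if b then true else c) ≡ encodeBool (b ∨ c)
    eq true c  = refl
    eq false c = refl

  tailsC : {t : Γ → Tree} {n : Γ → ℕ} → Computes e (λ _ → unary) n → e ⇝ t → e ⇝ (λ γ → tails (n γ) (t γ))
  tailsC {t} {n} cn ct = recode (λ γ → cong (λ m → tails m (t γ)) (length-replicate (n γ)))
    (foldrC {encA = λ _ → id} (λ γ as → tails (length as) (t γ)) (outBound ct) (recode (λ _ → refl) cn) ct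
      (recode (λ _ → refl) (expC (tl (hd (tl X)))))
      (λ γ as _ → ≤-trans (size-tails (length as) (t γ)) (size-out ct γ)))

  dropC : {A : Γ → Set} {encA : ∀ γ → A γ → Tree} {n : Γ → ℕ} {xs : ∀ γ → List (A γ)} →
          Computes e (λ _ → unary) n → Computes e (λ γ → encL (encA γ)) xs →
          Computes e (λ γ → encL (encA γ)) (λ γ → drop (n γ) (xs γ))
  dropC {encA = encA} {n} {xs} cn cxs = recode (λ γ → tails-encodeList (encA γ) (n γ) (xs γ)) (tailsC cn (raw cxs))

  monusC : {m n : Γ → ℕ} → Computes e (λ _ → unary) m → Computes e (λ _ → unary) n →
           Computes e (λ _ → unary) (λ γ → m γ ∸ n γ)
  monusC {m} {n} cm cn = recode (λ γ → cong (encL id) (drop-replicate (m γ) (n γ)))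
    (dropC {encA = λ _ → id} {xs = λ γ → replicate (m γ) leaf} cn (recode (λ _ → refl) cm))

  lengthC : {A : Γ → Set} {encA : ∀ γ → A γ → Tree} {xs : ∀ γ → List (A γ)} →
            Computes e (λ γ → encL (encA γ)) xs → Computes e (λ _ → unary) (λ γ → length (xs γ))
  lengthC {encA = encA} {xs} cxs = recode (λ γ → cong (encL id) (map-const leaf (xs γ)))
    (mapC {encA = encA} cxs {encB = λ _ → id} {f = λ _ _ → leaf} (recode (λ _ → refl) (expC nil)))

module _ {Γ : Set} {e : Γ → Tree} {A : Γ → Set} {encA : ∀ γ → A γ → Tree} {xs : ∀ γ → List (A γ)}
         (cxs : Computes e (λ γ → encL (encA γ)) xs)
           {P : ∀ γ → A γ → Set} {P? : ∀ γ a → Dec (P γ a)}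
           (cp : Computes (ext e encA) (λ _ → encodeBool) (λ (γ , a) → does (P? γ a))) where

  allC : Computes e (λ _ → encodeBool) (λ γ → does (All.all? (P? γ) (xs γ)))
  allC = recode (λ γ → cong encodeBool (eq γ (xs γ))) (nullC (filterC cxs {P? = λ γ a → ¬? (P? γ a)} (notC cp)))
    where
    eq : ∀ γ as → null (filter (λ a → ¬? (P? γ a)) as) ≡ does (All.all? (P? γ) as)
    eq γ [] = refl
    eq γ (a ∷ as) with does (P? γ a)
    ... | true  = eq γ as
    ... | false = refl

  anyC : Computes e (λ _ → encodeBool) (λ γ → does (Any.any? (P? γ) (xs γ)))
  anyC = recode (λ γ → cong encodeBool (eq γ (xs γ))) (notC (nullC (filterC cxs {P? = P?} cp)))
    where
    eq : ∀ γ as → not (null (filter (P? γ) as)) ≡ does (Any.any? (P? γ) as)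
    eq γ [] = refl
    eq γ (a ∷ as) with does (P? γ a)
    ... | true  = refl
    ... | false = eq γ as

module _ {Γ : Set} {e : Γ → Tree} where

  ≤?-C : {m n : Γ → ℕ} → Computes e (λ _ → unary) m → Computes e (λ _ → unary) n →
        Computes e (λ _ → encodeBool) (λ γ → does (m γ ≤? n γ))
  ≤?-C {m} {n} cm cn = recode (λ γ → cong encodeBool (null-∸ (m γ) (n γ)))
    (nullC {encA = λ _ → id} {xs = λ γ → replicate (m γ ∸ n γ) leaf} (recode (λ _ → refl) (monusC cm cn)))

  ≟-C : {n : Γ → ℕ} {u v : ∀ γ → Fin (n γ)} → Computes e (λ _ → encV) u → Computes e (λ _ → encV) v →
       Computes e (λ _ → encodeBool) (λ γ → does (u γ Fin.≟ v γ))
  ≟-C {u = u} {v} cu cv = recode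
    (λ γ → cong encodeBool (does-⇔ (mk⇔ (λ (u≤v , v≤u) → toℕ-injective (≤-antisym u≤v v≤u))
                                        (λ u≡v → ≤-reflexive (cong toℕ u≡v) , ≤-reflexive (cong toℕ (sym u≡v))))
                                   ((toℕ (u γ) ≤? toℕ (v γ)) ×-dec (toℕ (v γ) ≤? toℕ (u γ))) (u γ Fin.≟ v γ)))
    (andC (≤?-C (recode (λ _ → refl) cu) (recode (λ _ → refl) cv)) (≤?-C (recode (λ _ → refl) cv) (recode (λ _ → refl) cu)))

-- Reading the adjacency matrix

encodeRow : (I : Instance) → Fin (order I) → Tree
encodeRow I u = encodeList (tabulate λ v → encodeBool (Graph.adjacent (graph I) u v))

module _ {Γ : Set} {e : Γ → Tree} {I : Γ → Instance} (cI : Computes e (λ _ → encode) I) where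

  adjacentC : {u v : ∀ γ → Fin (order (I γ))} → Computes e (λ _ → encV) u → Computes e (λ _ → encV) v →
              Computes e (λ _ → encodeBool) (λ γ → Graph.adjacent (graph (I γ)) (u γ) (v γ))
  adjacentC {u} {v} cu cv = recode
    (λ γ → trans (cong (λ row → head (tails (toℕ (v γ)) row)) (head-tails (encodeRow (I γ)) (u γ)))
                 (head-tails (λ w → encodeBool (Graph.adjacent (graph (I γ)) (u γ) w)) (v γ)))
    (tailsC (recode (λ _ → refl) cv)
            (tailsC (recode (λ _ → refl) cu) (raw cI then expC (hd X)) then expC (hd X))
     then expC (hd X))

  rowsC : Computes e (λ _ → encL id) (λ γ → tabulate (encodeRow (I γ)))
  rowsC = recode (λ γ → cong encodeList (sym (map-id _))) (raw cI then expC (hd X))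

  -- The code of an instance does not store the order, so the vertices are generated from the rows:
  -- each row lengthens all earlier vertex codes by one leaf and puts vertex zero in front.
  allFinC : Computes e (λ _ → encL encV) (λ γ → allFin (order (I γ)))
  allFinC = recode (λ γ → cong (λ n → encL encV (allFin n)) (length-tabulate (encodeRow (I γ))))
    (foldrC {encA = λ _ → id} (λ γ as → encL encV (allFin (length as))) (con 1 ⊕ N ⊗ (con 2 ⊕ (N ⊕ N))) rowsC (expC nil)
      (recode (λ (γ , a , as) → cong (leaf ∙_) (cong encodeList (eq (length as))))
        (pairC {encA = λ _ → id} {encB = λ _ → encL id} (expC nil)
          (mapC {encA = λ _ → encV} {xs = λ (γ , a , as) → allFin (length as)}
                (recode (λ _ → refl) (expC (hd (tl X)))) {encB = λ _ → id} {f = λ _ v → leaf ∙ encV v}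
                (recode (λ _ → refl) (expC (cons nil (hd X)))))))
      λ γ as as≤ → ≤-trans (size-allFin (length as))
        (let m≤ = ≤-trans (≤-trans (length≤size id as) as≤) (size-out rowsC γ)
         in s≤s (*-mono-≤ m≤ (s≤s (s≤s (+-mono-≤ m≤ m≤))))))
    where
    N = outBound rowsC
    eq : ∀ n → map id (map (λ v → leaf ∙ encV v) (allFin n)) ≡ map encV (tabulate {n = n} Fin.suc)
    eq n = trans (map-id _) (trans (map-tabulate id (λ v → leaf ∙ encV v)) (sym (map-tabulate Fin.suc encV)))
    size-unary : ∀ n → size (unary n) ≡ suc (n + n)
    size-unary zero    = refl
    size-unary (suc n) = cong suc (cong suc (trans (size-unary n) (sym (+-suc n n))))
    go : ∀ m {n} (f : Fin n → Fin m) → size (encL encV (tabulate f)) ≤ suc (n * (2 + (m + m)))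
    go m {zero} f  = ≤-refl
    go m {suc n} f = s≤s (≤-trans (+-mono-≤ (≤-trans (≤-reflexive (size-unary (toℕ (f Fin.zero))))
                                              (s≤s (+-mono-≤ (<⇒≤ (toℕ<n (f Fin.zero))) (<⇒≤ (toℕ<n (f Fin.zero))))))
                                            (go m (f ∘ Fin.suc)))
                                  (≤-reflexive (+-suc (suc (m + m)) (n * (2 + (m + m))))))
    size-allFin : ∀ n → size (encL encV (allFin n)) ≤ suc (n * (2 + (n + n)))
    size-allFin n = go n id

-- Comparing with the number of cops in binary

digits : ℕᵇ → List Bool
digits ℕᵇ.zero  = []
digits 2[1+ b ] = true ∷ digits b
digits 1+[2 b ] = false ∷ digits b

value : List Bool → ℕ
value []           = 0
value (true ∷ ds)  = 2 * suc (value ds)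
value (false ∷ ds) = suc (2 * value ds)

value-digits : ∀ b → value (digits b) ≡ Bin.toℕ b
value-digits ℕᵇ.zero  = refl
value-digits 2[1+ b ] = cong (λ n → 2 * suc n) (value-digits b)
value-digits 1+[2 b ] = cong (λ n → suc (2 * n)) (value-digits b)

encodeBinary-digits : ∀ b → encodeBinary b ≡ encL encodeBool (digits b)
encodeBinary-digits ℕᵇ.zero  = refl
encodeBinary-digits 2[1+ b ] = cong (encodeBool true ∙_) (encodeBinary-digits b)
encodeBinary-digits 1+[2 b ] = cong (encodeBool false ∙_) (encodeBinary-digits b)

-- With `r = x ∸ a`, the difference `x ∸ r` is the minimum of `a` and `x`. Subtracting it from `r`
-- takes away a second `a`; if `x ≤ a`, both sides vanish.
∸-double : ∀ x a → (x ∸ a) ∸ (x ∸ (x ∸ a)) ≡ x ∸ 2 * a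
∸-double x a with ≤-total a x
... | inj₁ a≤x = trans (cong ((x ∸ a) ∸_) (m∸[m∸n]≡n a≤x))
  (trans (∸-+-assoc x a a) (cong (λ b → x ∸ (a + b)) (sym (+-identityʳ a))))
... | inj₂ x≤a = trans (cong (λ r → r ∸ (x ∸ r)) (m≤n⇒m∸n≡0 x≤a))
  (trans (0∸n≡0 x) (sym (m≤n⇒m∸n≡0 (≤-trans x≤a (m≤m+n a _)))))

-- Horner's scheme for x ∸ k: the remainder r = x ∸ a determines x ∸ 2a as r ∸ (x ∸ r), so no number exceeds x.
∸-digit : ∀ x d ds → x ∸ value (d ∷ ds) ≡
          (if d then ((x ∸ value ds) ∸ (x ∸ (x ∸ value ds))) ∸ 2 else ((x ∸ value ds) ∸ (x ∸ (x ∸ value ds))) ∸ 1)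
∸-digit x true ds  = trans (cong (x ∸_) (trans (*-suc 2 (value ds)) (+-comm 2 _)))
                     (trans (sym (∸-+-assoc x (2 * value ds) 2)) (cong (_∸ 2) (sym (∸-double x (value ds)))))
∸-digit x false ds = trans (cong (x ∸_) (+-comm 1 _))
                     (trans (sym (∸-+-assoc x (2 * value ds) 1)) (cong (_∸ 1) (sym (∸-double x (value ds)))))

size-unary-mono : ∀ {m n} → m ≤ n → size (unary m) ≤ size (unary n)
size-unary-mono {n = n} z≤n       = 1≤size (unary n)
size-unary-mono (s≤s m≤n) = s≤s (s≤s (size-unary-mono m≤n))

unaryC : ∀ {Γ : Set} {e : Γ → Tree} m → Computes e (λ _ → unary) (λ _ → m)
unaryC m = recode (λ _ → refl) (constC (ex m) (unary m) (eval-ex m))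
  where
  ex : ℕ → Exp
  ex zero    = nil
  ex (suc m) = cons nil (ex m)
  eval-ex : ∀ m x → eval (ex m) x ≡ unary m
  eval-ex zero x    = refl
  eval-ex (suc m) x = cong (leaf ∙_) (eval-ex m x)

module _ {Γ : Set} {e : Γ → Tree} {I : Γ → Instance} (cI : Computes e (λ _ → encode) I)
         {x : Γ → ℕ} (cx : Computes e (λ _ → unary) x) where

  -- The number of cops can be exponential in the size of its code, so it is never written in unary.
  -- The kernels get by with its truncation against numbers of polynomial size.
  monusCopsC : Computes e (λ _ → unary) (λ γ → x γ ∸ cops (I γ))
  monusCopsC = recode (λ γ → cong (λ k → unary (x γ ∸ k)) (trans (value-digits (fromℕ (cops (I γ)))) (toℕ-fromℕ (cops (I γ)))))
    (foldrC {encA = λ _ → encodeBool} (λ γ ds → unary (x γ ∸ value ds)) (outBound cx)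
      (recode (λ γ → encodeBinary-digits (fromℕ (cops (I γ)))) (raw cI then expC (tl X)))
      (raw cx)
      (recode (λ (γ , d , ds) → cong unary (sym (∸-digit (x γ) d ds)))
        (ifC {b = λ (γ , d , ds) → d} (recode (λ _ → refl) (expC (hd X)))
             (monusC (monusC r (monusC x′ r)) (unaryC 2)) (monusC (monusC r (monusC x′ r)) (unaryC 1))))
      λ γ ds _ → ≤-trans (size-unary-mono (m∸n≤m (x γ) (value ds))) (size-out cx γ))
    where
    env : Σ Γ (λ _ → Bool × List Bool) → Tree
    env (γ , d , ds) = encodeBool d ∙ (unary (x γ ∸ value ds) ∙ e γ)
    r : Computes env (λ _ → unary) (λ (γ , d , ds) → x γ ∸ value ds)
    r = recode (λ _ → refl) (expC (hd (tl X)))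
    x′ : Computes env (λ _ → unary) (λ (γ , d , ds) → x γ)
    x′ = expC (tl (tl X)) then restrict proj₁ cx

  ≤?-copsC : Computes e (λ _ → encodeBool) (λ γ → does (x γ ≤? cops (I γ)))
  ≤?-copsC = recode (λ γ → cong encodeBool (null-∸ (x γ) (cops (I γ))))
    (nullC {encA = λ _ → id} {xs = λ γ → replicate (x γ ∸ cops (I γ)) leaf} (recode (λ _ → refl) monusCopsC))

-- Twin classes

headOr : {A : Set} → A → List A → A
headOr a []      = a
headOr _ (x ∷ _) = x

lookup-injective : {A : Set} {xs : List A} → Unique xs → ∀ i j → lookup xs i ≡ lookup xs j → i ≡ j
lookup-injective (x∉ ∷ u) Fin.zero Fin.zero eq       = refl
lookup-injective (x∉ ∷ u) Fin.zero (Fin.suc j) eq    = contradiction eq (All.lookup x∉ (∈-lookup j))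
lookup-injective (x∉ ∷ u) (Fin.suc i) Fin.zero eq    = contradiction (sym eq) (All.lookup x∉ (∈-lookup i))
lookup-injective (x∉ ∷ u) (Fin.suc i) (Fin.suc j) eq = cong Fin.suc (lookup-injective u i j eq)

∈-drop⁻ : {A : Set} {v : A} (d : ℕ) (xs : List A) → v ∈ˡ drop d xs → v ∈ˡ xs
∈-drop⁻ zero xs v∈          = v∈
∈-drop⁻ (suc d) (x ∷ xs) v∈ = there (∈-drop⁻ d xs v∈)

lookup-∉-drop : {A : Set} {xs : List A} → Unique xs → ∀ d i → toℕ i < d → lookup xs i ∉ˡ drop d xs
lookup-∉-drop {xs = x ∷ xs} (x∉ ∷ u) (suc d) Fin.zero _ x∈             = All.lookup x∉ (∈-drop⁻ d xs x∈) refl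
lookup-∉-drop {xs = x ∷ xs} (x∉ ∷ u) (suc d) (Fin.suc i) (s≤s i<d) x∈ = lookup-∉-drop u d i i<d x∈

lookup-cong : {A : Set} {xs ys : List A} → xs ≡ ys → ∀ i j → toℕ i ≡ toℕ j → lookup xs i ≡ lookup ys j
lookup-cong {xs = xs} refl i j eq = cong (lookup xs) (toℕ-injective eq)

∈-length : {A : Set} {v : A} {xs : List A} → v ∈ˡ xs → 0 < length xs
∈-length (here _)  = s≤s z≤n
∈-length (there _) = s≤s z≤n

position : ∀ {n} {U : Subset n} {v} → v ∈ U → Fin ∣ U ∣
position here                        = Fin.zero
position {U = inside ∷ U} (there v∈)  = Fin.suc (position v∈)
position {U = outside ∷ U} (there v∈) = position v∈

member : ∀ {n} (U : Subset n) → Fin ∣ U ∣ → Fin n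
member (inside ∷ U) Fin.zero    = Fin.zero
member (inside ∷ U) (Fin.suc i) = Fin.suc (member U i)
member (outside ∷ U) i          = Fin.suc (member U i)

member-position : ∀ {n} {U : Subset n} {v} (v∈ : v ∈ U) → member U (position v∈) ≡ v
member-position here                        = refl
member-position {U = inside ∷ U} (there v∈)  = cong Fin.suc (member-position v∈)
member-position {U = outside ∷ U} (there v∈) = cong Fin.suc (member-position v∈)

position-injective : ∀ {n} {U : Subset n} {v w} (v∈ : v ∈ U) (w∈ : w ∈ U) → position v∈ ≡ position w∈ → v ≡ w
position-injective {U = U} v∈ w∈ eq = trans (sym (member-position v∈)) (trans (cong (member U) eq) (member-position w∈))

module _ {n : ℕ} (G : Graph n) where
  open Graph G

  Adj-sym : ∀ {u v} → Adj u v → Adj v u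
  Adj-sym {u} {v} = subst T (symmetric u v)

  Adj-irrefl : ∀ {v} → ¬ Adj v v
  Adj-irrefl {v} = subst T (irreflexive v)

  Twin : Fin n → Fin n → Set
  Twin v w = ∀ x → adjacent v x ≡ adjacent w x

  twin? : ∀ v w → Dec (Twin v w)
  twin? v w = map′ (λ all x → All.lookup all (∈-allFin x)) (λ tw → All.tabulate (λ {x} _ → tw x))
                   (All.all? (λ x → adjacent v x Bool.≟ adjacent w x) (allFin n))

  class : Fin n → List (Fin n)
  class v = filter (twin? v) (allFin n)

  adjacent? : ∀ v w → Dec (Adj v w)
  adjacent? v w = T? (adjacent v w)

  neighbours : Fin n → List (Fin n)
  neighbours v = filter (adjacent? v) (allFin n)

  -- The first t v + 1 members of the class of v.  At least one member is kept, so that there is a retraction.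
  kept : (Fin n → ℕ) → List (Fin n)
  kept t = filter (λ v → ¬? (Any.any? (v Fin.≟_) (drop (suc (t v)) (class v)))) (allFin n)

  induced : (vs : List (Fin n)) → Graph (length vs)
  induced vs = record
    { adjacent    = λ i j → adjacent (lookup vs i) (lookup vs j)
    ; symmetric   = λ i j → symmetric (lookup vs i) (lookup vs j)
    ; irreflexive = λ i → irreflexive (lookup vs i)
    }

  Twin-Adj : ∀ {u v} w → Twin u v → Adj u w → Adj v w
  Twin-Adj w tw = subst T (tw w)

  Twin-Adj₂ : ∀ {u u′ v v′} → Twin u u′ → Twin v v′ → Adj u v → Adj u′ v′
  Twin-Adj₂ {u′ = u′} tu tv a = Adj-sym (Twin-Adj u′ tv (Adj-sym (Twin-Adj _ tu a)))

  Twin-sym : ∀ {u v} → Twin u v → Twin v u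
  Twin-sym tw x = sym (tw x)

  Twin-trans : ∀ {u v w} → Twin u v → Twin v w → Twin u w
  Twin-trans tw tw′ x = trans (tw x) (tw′ x)

  class-cong : ∀ {v w} → Twin v w → class v ≡ class w
  class-cong tw = filter-≐ (twin? _) (twin? _) (Twin-trans (Twin-sym tw) , Twin-trans tw) (allFin n)

  class-unique : ∀ v → Unique (class v)
  class-unique v = filter⁺ (twin? v) (allFin⁺ n)

  neighbours-unique : ∀ v → Unique (neighbours v)
  neighbours-unique v = filter⁺ (adjacent? v) (allFin⁺ n)

  ∈-class : ∀ {v w} → w ∈ˡ class v → Twin v w
  ∈-class {v} w∈ = proj₂ (∈-filter⁻ (twin? v) {xs = allFin n} w∈)

  ∈-neighbours⁺ : ∀ {v w} → Adj v w → w ∈ˡ neighbours v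
  ∈-neighbours⁺ {v} a = ∈-filter⁺ (adjacent? v) (∈-allFin _) a

  ∈-neighbours⁻ : ∀ {v w} → w ∈ˡ neighbours v → Adj v w
  ∈-neighbours⁻ {v} w∈ = proj₂ (∈-filter⁻ (adjacent? v) {xs = allFin n} w∈)

  neighbours-cong : ∀ {v w} → Twin v w → neighbours v ≡ neighbours w
  neighbours-cong {v} {w} tw =
    filter-≐ (adjacent? v) (adjacent? w) ((λ {x} → Twin-Adj x tw) , (λ {x} → Twin-Adj x (Twin-sym tw))) (allFin n)

  nbr-of-connected : Connected → 2 ≤ n → ∀ v → ∃ (Adj v)
  nbr-of-connected conn 2≤n v with other v 2≤n
    where
    other : ∀ {n} (v : Fin n) → 2 ≤ n → ∃ λ w → v ≢ w
    other {suc zero} _ (s≤s ())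
    other {suc (suc n)} Fin.zero _    = Fin.suc Fin.zero , λ ()
    other {suc (suc n)} (Fin.suc v) _ = Fin.zero , λ ()
  ... | w , v≢w with conn v w
  ... | ε     = contradiction refl v≢w
  ... | a ◅ _ = _ , a

  module _ (t : Fin n → ℕ) (t-cong : ∀ {u v} → Twin u v → t u ≡ t v) where

    private
      vs : List (Fin n)
      vs = kept t
      P? : ∀ v → Dec (¬ Any (v ≡_) (drop (suc (t v)) (class v)))
      P? v = ¬? (Any.any? (v Fin.≟_) (drop (suc (t v)) (class v)))

    kept-unique : Unique vs
    kept-unique = filter⁺ P? (allFin⁺ n)

    emb : Fin (length vs) → Fin n
    emb = lookup vs

    emb-injective : ∀ {x y} → emb x ≡ emb y → x ≡ y
    emb-injective = lookup-injective kept-unique _ _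

    ∈-kept : ∀ {v} → v ∉ˡ drop (suc (t v)) (class v) → ∃ λ x → emb x ≡ v
    ∈-kept v∉ = let v∈ = ∈-filter⁺ P? (∈-allFin _) v∉ in Any.index v∈ , sym (lookup-index v∈)

    -- A vertex is deleted only if it comes after the first `suc (t v)` members of its class. The
    -- class is then at least that long, and these members survive, because `t` and `class` agree on
    -- twins.
    kept-or-many : ∀ v → (∃ λ x → emb x ≡ v) ⊎
                   ∃ λ (b : Fin (suc (t v)) → Fin (length vs)) → Injective _≡_ _≡_ b × (∀ j → Twin (emb (b j)) v)
    kept-or-many v with Any.any? (v Fin.≟_) (drop (suc (t v)) (class v))
    ... | no v∉ = inj₁ (∈-kept v∉)
    ... | yes v∈ = inj₂ (proj₁ ∘ b , b-injective , λ j → Twin-sym (subst (Twin v) (sym (proj₂ (b j))) (twin j)))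
      where
      t<length : suc (t v) ≤ length (class v)
      t<length = <⇒≤ (m∸n≢0⇒n<m (λ eq → <⇒≢ (∈-length v∈) (sym (trans (length-drop (suc (t v)) (class v)) eq))))
      u : Fin (suc (t v)) → Fin n
      u j = lookup (class v) (inject≤ j t<length)
      twin : ∀ j → Twin v (u j)
      twin j = ∈-class (∈-lookup (inject≤ j t<length))
      b : ∀ j → ∃ λ x → emb x ≡ u j
      b j = ∈-kept (subst (λ ws → u j ∉ˡ ws) (cong₂ (λ d → drop (suc d)) (t-cong (twin j)) (class-cong (twin j)))
              (lookup-∉-drop (class-unique v) (suc (t v)) (inject≤ j t<length)
                (subst (_< suc (t v)) (sym (toℕ-inject≤ j t<length)) (toℕ<n j))))
      b-injective : ∀ {i j} → proj₁ (b i) ≡ proj₁ (b j) → i ≡ j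
      b-injective {i} {j} eq = inject≤-injective t<length t<length i j (lookup-injective (class-unique v) _ _
        (trans (sym (proj₂ (b i))) (trans (cong emb eq) (proj₂ (b j)))))

    private
      retract : ∀ v → ∃ λ x → Twin (emb x) v × (∀ y → emb y ≡ v → x ≡ y)
      retract v with any? (λ x → emb x Fin.≟ v)
      ... | yes (x , refl) = x , (λ _ → refl) , λ y eq → emb-injective (sym eq)
      ... | no v∉ with kept-or-many v
      ...   | inj₁ v∈           = contradiction v∈ v∉
      ...   | inj₂ (b , _ , tw) = b Fin.zero , tw Fin.zero , λ y eq → contradiction (y , eq) v∉

    ret : Fin n → Fin (length vs)
    ret v = proj₁ (retract v)

    emb-ret : ∀ v → Twin (emb (ret v)) v
    emb-ret v = proj₁ (proj₂ (retract v))

    ret-emb : ∀ x → ret (emb x) ≡ x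
    ret-emb x = proj₂ (proj₂ (retract (emb x))) x refl

    ret-Adj : ∀ {u v} → Adj u v → Graph.Adj (induced vs) (ret u) (ret v)
    ret-Adj {u} {v} = Twin-Adj₂ (Twin-sym (emb-ret u)) (Twin-sym (emb-ret v))

    kept-connected : Connected → Graph.Connected (induced vs)
    kept-connected conn x y = subst (λ x → Graph.Walk (induced vs) x y) (ret-emb x)
      (subst (Graph.Walk (induced vs) (ret (emb x))) (ret-emb y) (gmap ret ret-Adj (conn (emb x) (emb y))))

    -- A kept vertex in `U` is coded by its position there. The neighbours of any other vertex lie
    -- in `U`, so its class is determined by a subset of `U`, and its rank among the first
    -- `suc (t v)` members of the class completes the code.
    kept-bound : ∀ U → IsVertexCover U → (∀ v → v ∉ U → suc (t v) ≤ ∣ U ∣) → length vs ≤ ∣ U ∣ + ∣ U ∣ * 2 ^ ∣ U ∣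
    kept-bound U cover t< = injective⇒≤ {f = code} code-injective
      where
      p = ∣ U ∣

      bit : Bool → Fin 2
      bit false = Fin.zero
      bit true  = Fin.suc Fin.zero

      bit-injective : ∀ b c → bit b ≡ bit c → b ≡ c
      bit-injective false false _ = refl
      bit-injective true true _   = refl

      nbhd : Fin n → Fin p → Fin 2
      nbhd v i = bit (adjacent v (member U i))

      nbhd-Twin : ∀ {v w} → v ∉ U → w ∉ U → nbhd v ≗ nbhd w → Twin v w
      nbhd-Twin {v} {w} v∉ w∉ eq x with x Subset.∈? U
      ... | yes x∈ = bit-injective _ _
        (subst (λ x → bit (adjacent v x) ≡ bit (adjacent w x)) (member-position x∈) (eq (position x∈)))
      ... | no x∉  = trans (nonadjacent v∉ x∉) (sym (nonadjacent w∉ x∉))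
        where
        nonadjacent : ∀ {u v} → u ∉ U → v ∉ U → adjacent u v ≡ false
        nonadjacent {u} {v} u∉ v∉ with adjacent u v | cover {u} {v} u∉ v∉
        ... | false | _ = refl
        ... | true  | h = ⊥-elim (h _)

      initial : Fin n → List (Fin n)
      initial v = take (suc (t v)) (class v)

      ∈-initial : ∀ x → emb x ∈ˡ initial (emb x)
      ∈-initial x with ∈-++⁻ (initial v) (subst (v ∈ˡ_) (sym (take++drop≡id (suc (t v)) (class v)))
                                            (∈-filter⁺ (twin? v) (∈-allFin v) (λ _ → refl)))
        where v = emb x
      ... | inj₁ v∈ = v∈
      ... | inj₂ v∈ = contradiction v∈ (proj₂ (∈-filter⁻ P? {xs = allFin n} (∈-lookup x)))

      rank : ∀ x → emb x ∉ U → Fin p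
      rank x v∉ = inject≤ (Any.index (∈-initial x))
        (≤-trans (≤-trans (≤-reflexive (length-take (suc (t (emb x))) (class (emb x)))) (m⊓n≤m _ _)) (t< (emb x) v∉))

      part : Fin (length vs) → Fin p ⊎ Fin (p * 2 ^ p)
      part x with emb x Subset.∈? U
      ... | yes v∈ = inj₁ (position v∈)
      ... | no v∉  = inj₂ (combine (rank x v∉) (funToFin (nbhd (emb x))))

      part-injective : ∀ x y → part x ≡ part y → x ≡ y
      part-injective x y eq with emb x Subset.∈? U | emb y Subset.∈? U
      part-injective x y eq | yes v∈ | yes w∈ = emb-injective (position-injective v∈ w∈ (inj₁-injective eq))
      part-injective x y () | yes v∈ | no w∉
      part-injective x y () | no v∉ | yes w∈
      part-injective x y eq | no v∉ | no w∉ = emb-injective (trans (lookup-index (∈-initial x))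
          (trans (lookup-cong (cong₂ (λ d → take (suc d)) (t-cong tw) (class-cong tw)) _ _ ranks)
                 (sym (lookup-index (∈-initial y)))))
        where
        codes = combine-injective (rank x v∉) (funToFin (nbhd (emb x))) (rank y w∉) (funToFin (nbhd (emb y))) (inj₂-injective eq)
        tw : Twin (emb x) (emb y)
        tw = nbhd-Twin v∉ w∉ (λ i → trans (sym (finToFun-funToFin (nbhd (emb x)) i))
               (trans (cong (λ k → finToFun k i) (proj₂ codes)) (finToFun-funToFin (nbhd (emb y)) i)))
        ranks : toℕ (Any.index (∈-initial x)) ≡ toℕ (Any.index (∈-initial y))
        ranks = trans (sym (toℕ-inject≤ _ _)) (trans (cong toℕ (proj₁ codes)) (toℕ-inject≤ _ _))

      code : Fin (length vs) → Fin (p + p * 2 ^ p)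
      code x = join p (p * 2 ^ p) (part x)

      code-injective : ∀ {x y} → code x ≡ code y → x ≡ y
      code-injective {x} {y} eq = part-injective x y
        (trans (sym (splitAt-join p _ (part x))) (trans (cong (Fin.splitAt p) eq) (splitAt-join p _ (part y))))

  degree-bound : ∀ U → IsVertexCover U → ∀ v → v ∉ U → length (neighbours v) ≤ ∣ U ∣
  degree-bound U cover v v∉ = injective⇒≤ {f = λ i → position (∈U i)}
    (λ {i} {j} eq → lookup-injective (neighbours-unique v) i j (position-injective (∈U i) (∈U j) eq))
    where
    ∈U : ∀ i → lookup (neighbours v) i ∈ U
    ∈U i with lookup (neighbours v) i Subset.∈? U
    ... | yes w∈ = w∈
    ... | no w∉  = contradiction (∈-neighbours⁻ (∈-lookup i)) (cover v∉ w∉)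

-- Edge covers and domination

-- Functions that a program has to compute branch by `if does`, to match `ifC`; this is the case
-- distinction for proofs about them.
if-dec : ∀ {A B : Set} (P : B → Set) (d : Dec A) {x y : B} → (A → P x) → (¬ A → P y) → P (if does d then x else y)
if-dec P (yes a) f g = f a
if-dec P (no ¬a) f g = g ¬a

spread : ∀ {A : Set} {k} (xs : List A) → length xs ≤ k → A → ∃ λ (c : Fin k → A) → ∀ {x} → x ∈ˡ xs → ∃ λ i → c i ≡ x
spread [] _ a             = (λ _ → a) , λ ()
spread (x ∷ xs) (s≤s ≤k) a with spread xs ≤k a
... | c , hit = (λ { Fin.zero → x ; (Fin.suc i) → c i }) ,
                λ { (here refl) → Fin.zero , refl ; (there x∈) → let i , eq = hit x∈ in Fin.suc i , eq }

module _ {n : ℕ} (G : Graph n) where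
  open Graph G

  first : Fin n → Fin n
  first v = headOr v (neighbours G v)

  -- A vertex v stands for the edge from v to first v.
  Covers : List (Fin n) → Fin n → Set
  Covers S x = Any (λ u → x ≡ u ⊎ x ≡ first u) S

  covers? : ∀ S x → Dec (Covers S x)
  covers? S x = Any.any? (λ u → (x Fin.≟ u) ⊎-dec (x Fin.≟ first u)) S

  remove : Fin n → List (Fin n) → List (Fin n)
  remove v = filter (λ w → ¬? (w Fin.≟ v))

  Redundant : Fin n → List (Fin n) → Set
  Redundant v S = Covers (remove v S) v × Covers (remove v S) (first v)

  redundant? : ∀ v S → Dec (Redundant v S)
  redundant? v S = covers? (remove v S) v ×-dec covers? (remove v S) (first v)

  prune : Fin n → List (Fin n) → List (Fin n)
  prune v S = if does (redundant? v S) then remove v S else S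

  pruned : List (Fin n) → List (Fin n)
  pruned = foldr prune (allFin n)

  edgeCover : List (Fin n)
  edgeCover = pruned (allFin n)

  -- One index per edge of a spanning forest of stars, so that edges of the same star share their centre.
  record StarForest (s : ℕ) : Set where
    field
      tip centre    : Fin s → Fin n
      tip-injective : ∀ {i j} → tip i ≡ tip j → i ≡ j
      tip≢centre    : ∀ {i j} → tip i ≢ centre j
      spanning       : ∀ x → ∃ λ j → x ≡ tip j ⊎ x ≡ centre j
      edge           : ∀ j → Adj (tip j) (centre j)

  module _ (nbr : ∀ v → ∃ (Adj v)) where

    first-Adj : ∀ v → Adj v (first v)
    first-Adj v with neighbours G v | ∈-neighbours⁺ G (proj₂ (nbr v)) | ∈-neighbours⁻ G {v}
    ... | w ∷ ws | _ | adj = adj (here refl)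

    private
      _⊆_ : List (Fin n) → List (Fin n) → Set
      S ⊆ S′ = ∀ {x} → x ∈ˡ S → x ∈ˡ S′

      ∈-remove⁻ : ∀ {v x} S → x ∈ˡ remove v S → x ∈ˡ S × x ≢ v
      ∈-remove⁻ {v} S = ∈-filter⁻ (λ w → ¬? (w Fin.≟ v)) {xs = S}

      ∈-remove⁺ : ∀ {v x} S → x ∈ˡ S → x ≢ v → x ∈ˡ remove v S
      ∈-remove⁺ {v} S = ∈-filter⁺ (λ w → ¬? (w Fin.≟ v))

      Covers-⊆ : ∀ {S S′ x} → S ⊆ S′ → Covers S x → Covers S′ x
      Covers-⊆ S⊆S′ c = let u , u∈ , eq = find c in lose (S⊆S′ u∈) eq

      Redundant-⊆ : ∀ S S′ {v} → S ⊆ S′ → Redundant v S → Redundant v S′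
      Redundant-⊆ S S′ {v} S⊆S′ (c , d) = Covers-⊆ ⊆-remove c , Covers-⊆ ⊆-remove d
        where
        ⊆-remove : remove v S ⊆ remove v S′
        ⊆-remove x∈ = let x∈S , x≢v = ∈-remove⁻ S x∈ in ∈-remove⁺ S′ (S⊆S′ x∈S) x≢v

      prune-⊆ : ∀ v S → prune v S ⊆ S
      prune-⊆ v S = if-dec (_⊆ S) (redundant? v S) (λ _ → proj₁ ∘ ∈-remove⁻ S) (λ _ → id)

      prune-covers : ∀ v S → (∀ x → Covers S x) → ∀ x → Covers (prune v S) x
      prune-covers v S cov x = if-dec (λ S′ → Covers S′ x) (redundant? v S) (λ r → go r (find (cov x))) (λ _ → cov x)
        where
        go : Redundant v S → (∃ λ u → u ∈ˡ S × (x ≡ u ⊎ x ≡ first u)) → Covers (remove v S) x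
        go (c , d) (u , u∈ , eq) with u Fin.≟ v
        go (c , d) (u , u∈ , eq)        | no u≢v   = lose (∈-remove⁺ S u∈ u≢v) eq
        go (c , d) (u , u∈ , inj₁ refl) | yes refl = c
        go (c , d) (u , u∈ , inj₂ refl) | yes refl = d

      prune-minimal : ∀ v S → v ∈ˡ prune v S → ¬ Redundant v (prune v S)
      prune-minimal v S = if-dec (λ S′ → v ∈ˡ S′ → ¬ Redundant v S′) (redundant? v S)
        (λ _ v∈ → contradiction refl (proj₂ (∈-remove⁻ S v∈))) (λ ¬r _ → ¬r)

      prune-unique : ∀ v S → Unique S → Unique (prune v S)
      prune-unique v S u = if-dec Unique (redundant? v S) (λ _ → filter⁺ _ u) (λ _ → u)

      covering : ∀ vs x → Covers (pruned vs) x
      covering [] x       = lose (∈-allFin x) (inj₁ refl)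
      covering (v ∷ vs) x = prune-covers v (pruned vs) (covering vs) x

      unique : ∀ vs → Unique (pruned vs)
      unique []       = allFin⁺ n
      unique (v ∷ vs) = prune-unique v (pruned vs) (unique vs)

      -- One pass over the vertices is enough: edges pruned later only shrink the cover, so an edge
      -- that survived its own test cannot become redundant afterwards.
      minimal : ∀ vs {v} → v ∈ˡ vs → v ∈ˡ pruned vs → ¬ Redundant v (pruned vs)
      minimal (v ∷ vs) (here refl) v∈S = prune-minimal v (pruned vs) v∈S
      minimal (w ∷ vs) (there v∈) v∈S r = minimal vs v∈ (prune-⊆ w (pruned vs) v∈S)
        (Redundant-⊆ (pruned (w ∷ vs)) (pruned vs) (prune-⊆ w (pruned vs)) r)

      S = edgeCover

    -- By minimality each edge has an end that no other chosen edge covers. This private end becomes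
    -- the tip, the other one the centre. If the tip of one edge were the centre of another, privacy
    -- would make the two edges equal, and the edge a loop.
    starForest : StarForest (length S)
    starForest = record
      { tip           = λ i → proj₁ (star i)
      ; centre         = λ i → proj₁ (proj₂ (star i))
      ; tip-injective = λ {i} {j} eq → private-tip i j (subst (Incident j) (sym eq) (tip-incident j))
      ; tip≢centre    = λ {i} {j} eq → tip≢centre i j eq
      ; spanning       = spanning
      ; edge           = λ i → proj₁ (proj₂ (proj₂ (star i)))
      }
      where
      end : Fin (length S) → Fin n
      end = lookup S
      Incident : Fin (length S) → Fin n → Set
      Incident j x = x ≡ end j ⊎ x ≡ first (end j)

      star : ∀ i → ∃ λ ℓ → ∃ λ z → Adj ℓ z × (ℓ ≡ end i × z ≡ first (end i) ⊎ ℓ ≡ first (end i) × z ≡ end i) ×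
                                   ¬ Covers (remove (end i) S) ℓ
      star i with covers? (remove (end i) S) (end i)
      ... | no ¬c = end i , first (end i) , first-Adj (end i) , inj₁ (refl , refl) , ¬c
      ... | yes c = first (end i) , end i , Adj-sym G (first-Adj (end i)) , inj₂ (refl , refl) ,
                    λ d → minimal (allFin n) (∈-allFin (end i)) (∈-lookup i) (c , d)

      ℓ z : Fin (length S) → Fin n
      ℓ i = proj₁ (star i)
      z i = proj₁ (proj₂ (star i))

      tip-incident : ∀ i → Incident i (ℓ i)
      tip-incident i with proj₁ (proj₂ (proj₂ (proj₂ (star i))))
      ... | inj₁ (eq , _) = inj₁ eq
      ... | inj₂ (eq , _) = inj₂ eq

      centre-incident : ∀ i → Incident i (z i)
      centre-incident i with proj₁ (proj₂ (proj₂ (proj₂ (star i))))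
      ... | inj₁ (_ , eq) = inj₂ eq
      ... | inj₂ (_ , eq) = inj₁ eq

      private-tip : ∀ i j → Incident j (ℓ i) → i ≡ j
      private-tip i j inc with end j Fin.≟ end i
      ... | yes eq = lookup-injective (unique (allFin n)) i j (sym eq)
      ... | no neq = contradiction (lose (∈-remove⁺ S (∈-lookup j) neq) inc) (proj₂ (proj₂ (proj₂ (proj₂ (star i)))))

      tip≢centre : ∀ i j → ℓ i ≢ z j
      tip≢centre i j eq with private-tip i j (subst (Incident j) (sym eq) (centre-incident j))
      ... | refl = Adj-irrefl G (subst (Adj (ℓ i)) (sym eq) (proj₁ (proj₂ (proj₂ (star i)))))

      spanning : ∀ x → ∃ λ j → x ≡ ℓ j ⊎ x ≡ z j
      spanning x with find (covering (allFin n) x)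
      ... | u , u∈ , eq = j , incident eq (proj₁ (proj₂ (proj₂ (proj₂ (star j)))))
        where
        j = Any.index u∈
        u≡ : u ≡ end j
        u≡ = lookup-index u∈
        incident : x ≡ u ⊎ x ≡ first u → (ℓ j ≡ end j × z j ≡ first (end j) ⊎ ℓ j ≡ first (end j) × z j ≡ end j) →
                   x ≡ ℓ j ⊎ x ≡ z j
        incident (inj₁ refl) (inj₁ (e , _)) = inj₁ (trans u≡ (sym e))
        incident (inj₁ refl) (inj₂ (_ , e)) = inj₂ (trans u≡ (sym e))
        incident (inj₂ eq) (inj₁ (_ , e))   = inj₂ (trans eq (trans (cong first u≡) (sym e)))
        incident (inj₂ eq) (inj₂ (e , _))   = inj₁ (trans eq (trans (cong first u≡) (sym e)))

  module _ {s : ℕ} (F : StarForest s) where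
    open StarForest F

    private
      tip? : ∀ x → Dec (∃ λ j → tip j ≡ x)
      tip? x = any? (λ j → tip j Fin.≟ x)

      centre-of : ∀ {x} → ¬ (∃ λ j → tip j ≡ x) → ∃ λ j → x ≡ centre j
      centre-of {x} ¬tip with spanning x
      ... | j , inj₁ eq = contradiction (j , sym eq) ¬tip
      ... | j , inj₂ eq = j , eq

    -- Stars have disjoint edges, one per centre, and the cover meets each of them.
    centres≤cover : ∀ U → IsVertexCover U → n ∸ s ≤ ∣ U ∣
    centres≤cover U cover = m≤n+o⇒m∸n≤o n s (injective⇒≤ {f = join s ∣ U ∣ ∘ code} λ {x} {y} eq → code-injective x y
        (trans (sym (splitAt-join s _ (code x))) (trans (cong (Fin.splitAt s) eq) (splitAt-join s _ (code y)))))
      where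
      endpoint : ∀ j → ∃ λ w → w ∈ U × (w ≡ centre j ⊎ w ≡ tip j)
      endpoint j with centre j Subset.∈? U | tip j Subset.∈? U
      ... | yes c∈ | _      = centre j , c∈ , inj₁ refl
      ... | no _   | yes ℓ∈ = tip j , ℓ∈ , inj₂ refl
      ... | no c∉  | no ℓ∉  = contradiction (edge j) (cover ℓ∉ c∉)

      -- An injection that yields `n ≤ s + ∣ U ∣`: a tip goes to its index, and any other vertex,
      -- being a centre, to an end in `U` of an edge of its star.
      code : Fin n → Fin s ⊎ Fin ∣ U ∣
      code x with tip? x
      ... | yes (j , _) = inj₁ j
      ... | no ¬tip    = inj₂ (position (proj₁ (proj₂ (endpoint (proj₁ (centre-of ¬tip))))))

      code-injective : ∀ x y → code x ≡ code y → x ≡ y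
      code-injective x y eq with tip? x | tip? y
      code-injective x y refl | yes (j , eq) | yes (_ , eq′) = trans (sym eq) eq′
      code-injective x y eq | no ¬ℓ | no ¬ℓ′ with centre-of ¬ℓ | centre-of ¬ℓ′
      ... | i , x≡ | j , y≡ with endpoint i | endpoint j
      ...   | w , w∈ , e | w′ , w′∈ , e′ = trans x≡ (trans (same e e′ (position-injective w∈ w′∈ (inj₂-injective eq))) (sym y≡))
        where
        same : ∀ {i j w w′} → w ≡ centre i ⊎ w ≡ tip i → w′ ≡ centre j ⊎ w′ ≡ tip j → w ≡ w′ → centre i ≡ centre j
        same (inj₁ e) (inj₁ e′) eq = trans (sym e) (trans eq e′)
        same (inj₁ e) (inj₂ e′) eq = contradiction (trans (sym e′) (trans (sym eq) e)) tip≢centre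
        same (inj₂ e) (inj₁ e′) eq = contradiction (trans (sym e) (trans eq e′)) tip≢centre
        same (inj₂ e) (inj₂ e′) eq = cong centre (tip-injective (trans (sym e) (trans eq e′)))

    Dominating : ∀ {k} → (Fin k → Fin n) → Set
    Dominating c = ∀ v → ∃ λ i → c i ≡ v ⊎ Adj (c i) v

    -- The cops stand on the vertices that are not tips. The `s` distinct tips leave at most `n ∸ s`
    -- of these, all centres are among them, and each tip is adjacent to its centre. Surplus cops go
    -- to `v₀`.
    centres-dominate : ∀ {k} → n ∸ s ≤ k → Fin n → ∃ λ (c : Fin k → Fin n) → Dominating c
    centres-dominate {k} n∸s≤k v₀ with spread D (≤-trans D≤ n∸s≤k) v₀
      where
      P? : ∀ x → Dec (¬ ∃ λ j → tip j ≡ x)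
      P? x = ¬? (tip? x)
      D : List (Fin n)
      D = filter P? (allFin n)
      ∉tip : ∀ i j → tip j ≢ lookup D i
      ∉tip i j eq = proj₂ (∈-filter⁻ P? {xs = allFin n} (∈-lookup i)) (j , eq)
      pick : Fin s ⊎ Fin (length D) → Fin n
      pick = [ tip , lookup D ]′
      pick-injective : ∀ a b → pick a ≡ pick b → a ≡ b
      pick-injective (inj₁ i) (inj₁ j) eq = cong inj₁ (tip-injective eq)
      pick-injective (inj₁ i) (inj₂ j) eq = contradiction eq (∉tip j i)
      pick-injective (inj₂ i) (inj₁ j) eq = contradiction (sym eq) (∉tip i j)
      pick-injective (inj₂ i) (inj₂ j) eq = cong inj₂ (lookup-injective (filter⁺ P? (allFin⁺ n)) i j eq)
      D≤ : length D ≤ n ∸ s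
      D≤ = m+n≤o⇒m≤o∸n (length D) (≤-trans (≤-reflexive (+-comm (length D) s))
             (injective⇒≤ {f = pick ∘ Fin.splitAt s} λ {x} {y} eq →
               trans (sym (join-splitAt s _ x)) (trans
                 (cong (join s _) (pick-injective (Fin.splitAt s x) (Fin.splitAt s y) eq)) (join-splitAt s _ y))))
    ... | c , hit = c , dominates
      where
      dominates : Dominating c
      dominates v with tip? v
      ... | no ¬tip = let i , eq = hit (∈-filter⁺ _ (∈-allFin v) ¬tip) in i , inj₁ eq
      ... | yes (j , refl) =
        let i , eq = hit (∈-filter⁺ _ (∈-allFin (centre j)) λ (_ , eq) → tip≢centre eq)
        in i , inj₂ (subst (λ u → Adj u (tip j)) (sym eq) (Adj-sym G (edge j)))

-- Computing the reductions in polynomial time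

≟ᵇ-C : {Γ : Set} {e : Γ → Tree} {b c : Γ → Bool} →
       Computes e (λ _ → encodeBool) b → Computes e (λ _ → encodeBool) c →
       Computes e (λ _ → encodeBool) (λ γ → does (b γ Bool.≟ c γ))
≟ᵇ-C {b = b} {c} cb cc = recode (λ γ → eq (b γ) (c γ)) (ifC cb cc (notC cc))
  where
  eq : ∀ b c → encodeBool (if b then c else not c) ≡ encodeBool (does (b Bool.≟ c))
  eq false false = refl
  eq false true  = refl
  eq true false  = refl
  eq true true   = refl

twinC : ∀ {Γ : Set} {e : Γ → Tree} {I : Γ → Instance} → Computes e (λ _ → encode) I →
        {u v : ∀ γ → Fin (order (I γ))} → Computes e (λ _ → encV) u → Computes e (λ _ → encV) v →
        Computes e (λ _ → encodeBool) (λ γ → does (twin? (graph (I γ)) (u γ) (v γ)))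
twinC {I = I} cI {u} {v} cu cv = recode (λ _ → refl)
  (allC (allFinC cI) {P? = λ γ x → Graph.adjacent (graph (I γ)) (u γ) x Bool.≟ Graph.adjacent (graph (I γ)) (v γ) x}
        (≟ᵇ-C (adjacentC (weaken cI) (weaken cu) newest) (adjacentC (weaken cI) (weaken cv) newest)))

classC : ∀ {Γ : Set} {e : Γ → Tree} {I : Γ → Instance} → Computes e (λ _ → encode) I →
         {v : ∀ γ → Fin (order (I γ))} → Computes e (λ _ → encV) v →
         Computes e (λ _ → encL encV) (λ γ → class (graph (I γ)) (v γ))
classC {I = I} cI {v} cv = filterC (allFinC cI) {P? = λ γ → twin? (graph (I γ)) (v γ)}
  (twinC (weaken cI) (weaken cv) newest)

neighboursC : ∀ {Γ : Set} {e : Γ → Tree} {I : Γ → Instance} → Computes e (λ _ → encode) I →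
              {v : ∀ γ → Fin (order (I γ))} → Computes e (λ _ → encV) v →
              Computes e (λ _ → encL encV) (λ γ → neighbours (graph (I γ)) (v γ))
neighboursC {I = I} cI {v} cv = filterC (allFinC cI) {P? = λ γ → adjacent? (graph (I γ)) (v γ)}
  (adjacentC (weaken cI) (weaken cv) newest)

firstC : ∀ {Γ : Set} {e : Γ → Tree} {I : Γ → Instance} → Computes e (λ _ → encode) I →
         {v : ∀ γ → Fin (order (I γ))} → Computes e (λ _ → encV) v →
         Computes e (λ _ → encV) (λ γ → first (graph (I γ)) (v γ))
firstC {I = I} cI {v} cv = recode (λ γ → eq (v γ) (neighbours (graph (I γ)) (v γ)))
  (ifC (nullC (neighboursC cI cv)) (raw cv) (raw (neighboursC cI cv) then expC (hd X)))
  where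
  eq : ∀ {n} (v : Fin n) ws → (if null ws then encV v else head (encL encV ws)) ≡ encV (headOr v ws)
  eq v []       = refl
  eq v (w ∷ ws) = refl

coversC : ∀ {Γ : Set} {e : Γ → Tree} {I : Γ → Instance} → Computes e (λ _ → encode) I →
          {S : ∀ γ → List (Fin (order (I γ)))} {x : ∀ γ → Fin (order (I γ))} →
          Computes e (λ _ → encL encV) S → Computes e (λ _ → encV) x →
          Computes e (λ _ → encodeBool) (λ γ → does (covers? (graph (I γ)) (S γ) (x γ)))
coversC {I = I} cI {S} {x} cS cx = anyC cS {P? = λ γ u → (x γ Fin.≟ u) ⊎-dec (x γ Fin.≟ first (graph (I γ)) u)}
  (orC (≟-C (weaken cx) newest) (≟-C (weaken cx) (firstC (weaken cI) newest)))

removeC : ∀ {Γ : Set} {e : Γ → Tree} (I : Γ → Instance) →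
          {S : ∀ γ → List (Fin (order (I γ)))} {v : ∀ γ → Fin (order (I γ))} →
          Computes e (λ _ → encL encV) S → Computes e (λ _ → encV) v →
          Computes e (λ _ → encL encV) (λ γ → remove (graph (I γ)) (v γ) (S γ))
removeC I {v = v} cS cv = filterC cS {P? = λ γ w → ¬? (w Fin.≟ v γ)} (notC (≟-C newest (weaken cv)))

edgeCoverC : ∀ {Γ : Set} {e : Γ → Tree} {I : Γ → Instance} → Computes e (λ _ → encode) I →
             Computes e (λ _ → encL encV) (λ γ → edgeCover (graph (I γ)))
edgeCoverC {Γ} {e} {I} cI = recode (λ _ → refl)
  (foldrC {encA = λ _ → encV} (λ γ vs → encL encV (pruned (graph (I γ)) vs)) (outBound all) all (raw all)
    (raw (ifC (andC (coversC I′ S-v v) (coversC I′ S-v (firstC I′ v))) S-v S))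
    λ γ vs _ → ≤-trans (smaller (graph (I γ)) vs) (size-out all γ))
  where
  all : Computes e (λ _ → encL encV) (λ γ → allFin (order (I γ)))
  all = allFinC cI
  env : Σ Γ (λ γ → Fin (order (I γ)) × List (Fin (order (I γ)))) → Tree
  env (γ , v , vs) = encV v ∙ (encL encV (pruned (graph (I γ)) vs) ∙ e γ)
  I′ : Computes env (λ _ → encode) (I ∘ proj₁)
  I′ = expC (tl (tl X)) then restrict proj₁ cI
  v : Computes env (λ _ → encV) (λ (γ , v , vs) → v)
  v = recode (λ _ → refl) (expC (hd X))
  S : Computes env (λ _ → encL encV) (λ (γ , v , vs) → pruned (graph (I γ)) vs)
  S = recode (λ _ → refl) (expC (hd (tl X)))
  S-v : Computes env (λ _ → encL encV) (λ (γ , v , vs) → remove (graph (I γ)) v (pruned (graph (I γ)) vs))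
  S-v = removeC (I ∘ proj₁) S v
  smaller : ∀ {n} (G : Graph n) vs → size (encL encV (pruned G vs)) ≤ size (encL encV (allFin n))
  smaller G []       = ≤-refl
  smaller G (v ∷ vs) = if-dec (λ S → size (encL encV S) ≤ _) (redundant? G v (pruned G vs))
    (λ _ → ≤-trans (size-filter encV _ (pruned G vs)) (smaller G vs)) (λ _ → smaller G vs)

-- The nested difference is the minimum of the length and `k`. It is a short unary substitute for a
-- binary `k`, and dropping more entries than there are has no further effect.
drop-∸-∸ : ∀ {A : Set} k (xs : List A) → drop (length xs ∸ (length xs ∸ k)) xs ≡ drop k xs
drop-∸-∸ zero xs          = cong (λ d → drop d xs) (n∸n≡0 (length xs))
drop-∸-∸ (suc k) []       = refl
drop-∸-∸ (suc k) (x ∷ xs) = trans (cong (λ d → drop d (x ∷ xs)) (+-∸-assoc 1 (m∸n≤m (length xs) k))) (drop-∸-∸ k xs)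

dropCopsC : ∀ {Γ : Set} {e : Γ → Tree} {I : Γ → Instance} → Computes e (λ _ → encode) I →
            {A : Γ → Set} {encA : ∀ γ → A γ → Tree} {xs : ∀ γ → List (A γ)} → Computes e (λ γ → encL (encA γ)) xs →
            Computes e (λ γ → encL (encA γ)) (λ γ → drop (cops (I γ)) (xs γ))
dropCopsC {I = I} cI {encA = encA} {xs} cxs = recode (λ γ → cong (encL (encA γ)) (drop-∸-∸ (cops (I γ)) (xs γ)))
  (dropC (monusC (lengthC cxs) (monusCopsC cI (lengthC cxs))) cxs)

module _ (t : (I : Instance) → Fin (order I) → ℕ)
         (dropt : ∀ {Γ : Set} {e : Γ → Tree} {I : Γ → Instance} → Computes e (λ _ → encode) I →
                  {v : ∀ γ → Fin (order (I γ))} → Computes e (λ _ → encV) v →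
                  {xs : ∀ γ → List (Fin (order (I γ)))} → Computes e (λ _ → encL encV) xs →
                  Computes e (λ _ → encL encV) (λ γ → drop (t (I γ) (v γ)) (xs γ))) where

  -- The threshold is accessed only through `dropt`, since for the capture games it is the number of
  -- cops, which may be too large to be written in unary.
  keptC : ∀ {Γ : Set} {e : Γ → Tree} {I : Γ → Instance} → Computes e (λ _ → encode) I →
          Computes e (λ _ → encL encV) (λ γ → kept (graph (I γ)) (t (I γ)))
  keptC {e = e} {I} cI = filterC (allFinC cI)
    {P? = λ γ v → ¬? (Any.any? (v Fin.≟_) (drop (suc (t (I γ) v)) (class (graph (I γ)) v)))}
    (notC (anyC tail-of-class {P? = λ { (γ , v) w → v Fin.≟ w }} (≟-C (weaken newest) newest)))
    where
    tail-of-class : Computes (ext e (λ _ → encV)) (λ _ → encL encV) (λ (γ , v) → drop (suc (t (I γ) v)) (class (graph (I γ)) v))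
    tail-of-class = recode (λ (γ , v) → cong (encL encV) (drop-drop 1 (t (I γ) v) (class (graph (I γ)) v)))
      (dropt (weaken cI) newest (dropC (unaryC 1) (classC (weaken cI) newest)))

encode-induced : ∀ {n} (G : Graph n) (vs : List (Fin n)) →
  encodeList (tabulate λ i → encodeList (tabulate λ j → encodeBool (Graph.adjacent (induced G vs) i j))) ≡
  encL (λ u → encL (λ v → encodeBool (Graph.adjacent G u v)) vs) vs
encode-induced G vs = cong encodeList (trans
  (tabulate-cong (λ i → cong encodeList (tabulate-∘-lookup vs (λ v → encodeBool (Graph.adjacent G (lookup vs i) v)))))
  (tabulate-∘-lookup vs (λ u → encL (λ v → encodeBool (Graph.adjacent G u v)) vs)))
  where
  tabulate-∘-lookup : ∀ {A B : Set} (xs : List A) (f : A → B) → tabulate (f ∘ lookup xs) ≡ map f xs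
  tabulate-∘-lookup xs f = trans (sym (map-tabulate (lookup xs) f)) (cong (map f) (tabulate-lookup xs))

inducedC : ∀ {Γ : Set} {e : Γ → Tree} {I : Γ → Instance} → Computes e (λ _ → encode) I →
           {vs : ∀ γ → List (Fin (order (I γ)))} → Computes e (λ _ → encL encV) vs →
           (conn : ∀ γ → Graph.Connected (induced (graph (I γ)) (vs γ))) →
           Computes e (λ _ → encode) (λ γ → record { order = length (vs γ) ; graph = induced (graph (I γ)) (vs γ)
                                                    ; connected = conn γ ; cops = cops (I γ) })
inducedC {I = I} cI {vs} cvs conn = recode (λ γ → cong (_∙ encodeBinary (fromℕ (cops (I γ)))) (eq γ))
  (pairC (mapC cvs {encB = λ _ → encL encodeBool} (mapC (weaken cvs) {f = λ { (γ , u) v → Graph.adjacent (graph (I γ)) u v }}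
             (adjacentC (weaken (weaken cI)) (weaken newest) newest)))
         (raw cI then expC (tl X)))
  where
  eq : ∀ γ → encL (encL encodeBool) (map (λ u → map (Graph.adjacent (graph (I γ)) u) (vs γ)) (vs γ)) ≡ _
  eq γ = trans (cong encodeList (trans (sym (map-∘ (vs γ))) (map-cong (λ u → cong encodeList (sym (map-∘ (vs γ)))) (vs γ))))
               (sym (encode-induced (graph (I γ)) (vs γ)))

polynomialTime-encode : ∀ {f : Instance → Instance} → Computes encode (λ _ → encode) f → PolynomialTime f
polynomialTime-encode c = let a , d , ≤ad = ⟦⟧-monomial (bound c) in
  program c , a , d , λ I → let t , r , t≤ = run c I in t , r , ≤-trans t≤ (≤ad (instanceSize I) (1≤size (encode I)))

-- Games

occupied? : ∀ {n k} (c : Cops n k) v → Dec (Occupied c v)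
occupied? c v = any? (λ i → c i Fin.≟ v)

module _ {n₁ n₂ k : ℕ} (R₁ : Rules n₁ k) (R₂ : Rules n₂ k) where
  private
    module R₁ = Rules R₁
    module R₂ = Rules R₂

  -- Cop moves are copied from the first game to the second, robber moves are pulled back. Reaching
  -- the goal in the first game, or a robber move without counterpart, need only lead to a position
  -- won in the second; the surrounding game relies on this freedom. `mobile` serves the existence
  -- requirement of `reply`.
  record Simulation (_~_ : Cops n₁ k × Fin n₁ → Cops n₂ k × Fin n₂ → Set) : Set where
    field
      goal       : ∀ {c r d q} → (c , r) ~ (d , q) → R₁.CopsGoal c r → CopsToMove R₂ d q
      goal′      : ∀ {c r d q} → (c , r) ~ (d , q) → R₁.CopsGoal c r → RobberToMove R₂ d q
      copMove    : ∀ {c c′ r d q} → (c , r) ~ (d , q) → (∀ i → R₁.CopMove (c i) (c′ i)) →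
                   ∃ λ d′ → (∀ i → R₂.CopMove (d i) (d′ i)) × (c′ , r) ~ (d′ , q)
      mobile     : ∀ {c r d q} → (c , r) ~ (d , q) → ∃ (R₁.RobberMove c r) → R₂.CopsGoal d q ⊎ ∃ (R₂.RobberMove d q)
      robberMove : ∀ {c r d q q′} → (c , r) ~ (d , q) → R₂.RobberMove d q q′ →
                   CopsToMove R₂ d q′ ⊎ ∃ λ r′ → R₁.RobberMove c r r′ × (c , r′) ~ (d , q′)

    mutual
      transfer : ∀ {c r d q} → (c , r) ~ (d , q) → CopsToMove R₁ c r → CopsToMove R₂ d q
      transfer p (won g)        = goal p g
      transfer p (move c′ mv s) = let d′ , mv′ , p′ = copMove p mv in move d′ mv′ (transfer′ p′ s)

      transfer′ : ∀ {c r d q} → (c , r) ~ (d , q) → RobberToMove R₁ c r → RobberToMove R₂ d q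
      transfer′ p (won g)     = goal′ p g
      transfer′ p (reply e s) with mobile p e
      ... | inj₁ g  = won g
      ... | inj₂ e′ = reply e′ λ q′ mv → [ id , (λ (r′ , mv′ , p′) → transfer p′ (s r′ mv′)) ]′ (robberMove p mv)

module _ {n : ℕ} (G : Graph n) where
  open Graph G

  module _ {P : Fin n → Set} where

    private
      Short : ∀ {u v} → Walk u v → Set
      Short {u} {v} w = ∃ λ (w′ : Walk u v) → IsPath w′ × edges w′ ≤ edges w × All P (vertices w′)

    suffix : ∀ {u v x} (w : Walk u v) → IsPath w → All P (vertices w) → x ∈ˡ vertices w →
             ∃ λ (w′ : Walk x v) → IsPath w′ × edges w′ ≤ edges w × All P (vertices w′)
    suffix ε path ps (here refl)        = ε , path , z≤n , ps
    suffix w@(_ ◅ _) path ps (here refl) = w , path , ≤-refl , ps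
    suffix (_ ◅ w) (_ ∷ path) (_ ∷ ps) (there x∈) =
      let w′ , path′ , ≤w , ps′ = suffix w path ps x∈ in w′ , path′ , m≤n⇒m≤1+n ≤w , ps′

    -- Loop erasure. Replacing the vertices of a path by twins may repeat a vertex, whereas a fast
    -- robber has to move along a path.
    shorten : ∀ {u v} (w : Walk u v) → All P (vertices w) → Short w
    shorten ε ps = ε , [] ∷ [] , z≤n , ps
    shorten {u} (a ◅ w) (p ∷ ps) with shorten w ps
    ... | w′ , path , ≤w , ps′ with Any.any? (u Fin.≟_) (vertices w′)
    ...   | yes u∈ = let w″ , path″ , ≤w′ , ps″ = suffix w′ path ps′ u∈ in w″ , path″ , m≤n⇒m≤1+n (≤-trans ≤w′ ≤w) , ps″
    ...   | no u∉  = a ◅ w′ , All.tabulate (λ x∈ eq → u∉ (subst (_∈ˡ vertices w′) (sym eq) x∈)) ∷ path , s≤s ≤w , p ∷ ps′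

  stay-or-caught : ∀ {k} s (c : Cops n k) r → Occupied c r ⊎ ∃ (Rules.RobberMove (fastRobberRules G k s) c r)
  stay-or-caught s c r with occupied? c r
  ... | yes o = inj₁ o
  ... | no ¬o = inj₂ (r , ε , [] ∷ [] , z≤n , ¬o ∷ [])

  -- A robber without an unoccupied neighbour has already lost, so the existence requirement of
  -- `reply` can always be met or bypassed.
  surrounded-or-mobile : ∀ {k} (c : Cops n k) r →
    Rules.CopsGoal (surroundingRules G k) c r ⊎ ∃ λ v → Adj r v × ¬ Occupied c v
  surrounded-or-mobile c r with any? (λ v → adjacent? G r v ×-dec ¬? (occupied? c v))
  ... | yes e = inj₂ e
  ... | no ¬e = inj₁ λ v a → decidable-stable (occupied? c v) (λ ¬occ → ¬e (v , a , ¬occ))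

-- Passing strategies down to the kernel

record Retract {n m : ℕ} (G : Graph n) (H : Graph m) : Set where
  field
    ι          : Fin m → Fin n
    π          : Fin n → Fin m
    πι         : ∀ x → π (ι x) ≡ x
    ιπ         : ∀ v → Twin G (ι (π v)) v
    adjacent-ι : ∀ x y → Graph.adjacent H x y ≡ Graph.adjacent G (ι x) (ι y)

module _ {n m : ℕ} {G : Graph n} {H : Graph m} (E : Retract G H) where
  open Retract E
  private
    module G = Graph G
    module H = Graph H

  ι-inj : ∀ {x y} → ι x ≡ ι y → x ≡ y
  ι-inj eq = trans (sym (πι _)) (trans (cong π eq) (πι _))

  lower-Adj : ∀ {u v x y} → Twin G (ι x) u → Twin G (ι y) v → G.Adj u v → H.Adj x y
  lower-Adj {x = x} {y} tu tv a = subst T (sym (adjacent-ι x y)) (Twin-Adj₂ G (Twin-sym G tu) (Twin-sym G tv) a)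

  raise-Adj : ∀ {u v x y} → Twin G (ι x) u → Twin G (ι y) v → H.Adj x y → G.Adj u v
  raise-Adj {x = x} {y} tu tv a = Twin-Adj₂ G tu tv (subst T (adjacent-ι x y) a)

  lower-Refl : ∀ {u v} → ReflClosure G.Adj u v → ReflClosure H.Adj (π u) (π v)
  lower-Refl [ a ] = [ lower-Adj (ιπ _) (ιπ _) a ]
  lower-Refl stay  = stay

  raise-Refl : ∀ {x y} → ReflClosure H.Adj x y → ReflClosure G.Adj (ι x) (ι y)
  raise-Refl [ a ] = [ raise-Adj (λ _ → refl) (λ _ → refl) a ]
  raise-Refl stay  = stay

  raise-walk : ∀ {x y} (w : H.Walk x y) → ∃ λ (w′ : G.Walk (ι x) (ι y)) →
               G.vertices w′ ≡ map ι (H.vertices w) × G.edges w′ ≡ H.edges w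
  raise-walk ε       = ε , refl , refl
  raise-walk (a ◅ w) = let w′ , vs , es = raise-walk w in
    raise-Adj (λ _ → refl) (λ _ → refl) a ◅ w′ , cong (_ ∷_) vs , cong suc es

  module _ {k : ℕ} where

    -- The robber of `H` also lives in `G`, through `ι`, and the cops of `G` are replaced by their
    -- images under `π`. Since `π` fixes the vertices of `H`, any of these that is occupied in `G`
    -- is occupied in `H` too.
    Below : Cops n k × Fin n → Cops m k × Fin m → Set
    Below (c , r) (d , q) = (∀ i → d i ≡ π (c i)) × r ≡ ι q

    private
      occ : ∀ {c : Cops n k} {d : Cops m k} {y} → (∀ i → d i ≡ π (c i)) → Occupied c (ι y) → Occupied d y
      occ d≡ (i , eq) = i , trans (d≡ i) (trans (cong π eq) (πι _))

    below-active : Simulation (fullyActiveRules G k) (fullyActiveRules H k) Below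
    below-active = record
      { goal       = λ { (d≡ , refl) g → won (occ d≡ g) }
      ; goal′      = λ { (d≡ , refl) g → won (occ d≡ g) }
      ; copMove    = λ { {c′ = c′} (d≡ , refl) mv → π ∘ c′ ,
                         (λ i → subst (λ x → H.Adj x (π (c′ i))) (sym (d≡ i)) (lower-Adj (ιπ _) (ιπ _) (mv i))) ,
                         (λ _ → refl) , refl }
      ; mobile     = λ { (d≡ , refl) (v , a) → inj₂ (π v , lower-Adj (λ _ → refl) (ιπ v) a) }
      ; robberMove = λ { (d≡ , refl) a → inj₂ (ι _ , raise-Adj (λ _ → refl) (λ _ → refl) a , d≡ , refl) }
      }

    below-fast : ∀ s → Simulation (fastRobberRules G k s) (fastRobberRules H k s) Below
    below-fast s = record
      { goal       = λ { (d≡ , refl) g → won (occ d≡ g) }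
      ; goal′      = λ { (d≡ , refl) g → won (occ d≡ g) }
      ; copMove    = λ { {c′ = c′} (d≡ , refl) mv → π ∘ c′ ,
                         (λ i → subst (λ x → ReflClosure H.Adj x (π (c′ i))) (sym (d≡ i)) (lower-Refl (mv i))) ,
                         (λ _ → refl) , refl }
      ; mobile     = λ { {d = d} {q} (d≡ , refl) _ → stay-or-caught H s d q }
      ; robberMove = λ { (d≡ , refl) (w , path , ≤s , free) → inj₂ (ι _ , raise d≡ w path ≤s free , d≡ , refl) }
      }
      where
      raise : ∀ {c : Cops n k} {d : Cops m k} {x y} → (∀ i → d i ≡ π (c i)) → (w : H.Walk x y) → H.IsPath w → H.edges w ≤ s →
              All (λ v → ¬ Occupied d v) (H.vertices w) → Rules.RobberMove (fastRobberRules G k s) c (ι x) (ι y)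
      raise d≡ w path ≤s free with raise-walk w
      ... | w′ , vs , es = w′ , subst Unique (sym vs) (Unique.map⁺ ι-inj path) , subst (_≤ s) (sym es) ≤s ,
                           subst (All _) (sym vs) (All.map⁺ (All.map (λ ¬o o → ¬o (occ d≡ o)) free))

    below-surrounding : Simulation (surroundingRules G k) (surroundingRules H k) Below
    below-surrounding = record
      { goal       = λ { (d≡ , refl) g → won (surround d≡ g) }
      ; goal′      = λ { (d≡ , refl) g → won (surround d≡ g) }
      ; copMove    = λ { {c′ = c′} (d≡ , refl) mv → π ∘ c′ ,
                         (λ i → subst (λ x → ReflClosure H.Adj x (π (c′ i))) (sym (d≡ i)) (lower-Refl (mv i))) ,
                         (λ _ → refl) , refl }
      ; mobile     = λ { {d = d} {q} _ _ → Sum.map₂ (λ (v , a , ¬o) → v , [ a ] , ¬o) (surrounded-or-mobile H d q) }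
      ; robberMove = λ { (d≡ , refl) (mv , ¬o) → inj₂ (ι _ , (raise-Refl mv , λ o → ¬o (occ d≡ o)) , d≡ , refl) }
      }
      where
      surround : ∀ {c : Cops n k} {d : Cops m k} {q} → (∀ i → d i ≡ π (c i)) → (∀ v → G.Adj (ι q) v → Occupied c v) →
                 ∀ y → H.Adj q y → Occupied d y
      surround d≡ g y a = occ d≡ (g (ι y) (raise-Adj (λ _ → refl) (λ _ → refl) a))

    win-below : (R₁ : Rules n k) (R₂ : Rules m k) → Simulation R₁ R₂ Below → CopsWin R₁ → CopsWin R₂
    win-below R₁ R₂ sim (c , s) = π ∘ c , λ q → Simulation.transfer sim ((λ _ → refl) , refl) (s (ι q))

-- Passing strategies back up from the kernel

module _ {n m : ℕ} {G : Graph n} {H : Graph m} (E : Retract G H) {Reduced : Fin n → Set}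
         (Reduced-Twin : ∀ {u v} → Twin G u v → Reduced u → Reduced v)
         (image-or-reduced : ∀ v → (∃ λ x → Retract.ι E x ≡ v) ⊎ Reduced v) where
  open Retract E
  private
    module G = Graph G
    module H = Graph H

  -- Embeddings of H which differ from ι only by twins.  When the robber enters a vertex outside the
  -- image, the embedding is changed at one vertex rather than applying an automorphism to the position.
  record Embedding : Set where
    field
      at        : Fin m → Fin n
      injective : ∀ {x y} → at x ≡ at y → x ≡ y
      twin      : ∀ x → Twin G (ι x) (at x)
      covers    : ∀ v → (∃ λ x → at x ≡ v) ⊎ Reduced v

  open Embedding

  initially : Embedding
  initially = record { at = ι ; injective = ι-inj E ; twin = λ _ _ → refl ; covers = image-or-reduced }

  -- The vertex given up by the image at `x` is a twin of `s`, hence in a reduced class, and so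
  -- `covers` survives the change.
  relocate : (F : Embedding) (x : Fin m) {s : Fin n} → ¬ (∃ λ y → at F y ≡ s) → Reduced s → Twin G (ι x) s →
             ∃ λ (F′ : Embedding) → at F′ x ≡ s × (∀ y → y ≢ x → at F′ y ≡ at F y)
  relocate F x {s} s∉ red tw =
    record { at = at′ ; injective = λ {y} {z} → inj y z ; twin = twin′ ; covers = covers′ } , at-x , at-y
    where
    at′ : Fin m → Fin n
    at′ y = if does (y Fin.≟ x) then s else at F y
    at-x : at′ x ≡ s
    at-x = if-dec (_≡ s) (x Fin.≟ x) (λ _ → refl) (λ x≢x → contradiction refl x≢x)
    at-y : ∀ y → y ≢ x → at′ y ≡ at F y
    at-y y y≢x = if-dec (_≡ at F y) (y Fin.≟ x) (λ y≡x → contradiction y≡x y≢x) (λ _ → refl)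
    inj : ∀ y z → at′ y ≡ at′ z → y ≡ z
    inj y z eq with y Fin.≟ x | z Fin.≟ x
    ... | yes refl | yes refl = refl
    ... | yes refl | no _     = contradiction (z , sym eq) s∉
    ... | no _     | yes refl = contradiction (y , eq) s∉
    ... | no _     | no _     = injective F eq
    twin′ : ∀ y → Twin G (ι y) (at′ y)
    twin′ y = if-dec (Twin G (ι y)) (y Fin.≟ x) (λ { refl → tw }) (λ _ → twin F y)
    covers′ : ∀ v → (∃ λ y → at′ y ≡ v) ⊎ Reduced v
    covers′ v with covers F v
    ... | inj₂ red′ = inj₂ red′
    ... | inj₁ (y , refl) with y Fin.≟ x
    ...   | yes refl = inj₂ (Reduced-Twin (Twin-trans G (Twin-sym G tw) (twin F y)) red)
    ...   | no y≢x   = inj₁ (y , at-y y y≢x)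

  -- Distinct twins are not adjacent, so a cop that stays in `H` must be lifted to one that stays in
  -- `G`; hence the third hypothesis.
  raise-Refl′ : ∀ {u v x y} → Twin G (ι x) u → Twin G (ι y) v → (x ≡ y → u ≡ v) → ReflClosure H.Adj x y → ReflClosure G.Adj u v
  raise-Refl′ tu tv eq [ a ] = [ raise-Adj E tu tv a ]
  raise-Refl′ tu tv eq stay with refl ← eq refl = stay

  module _ {k : ℕ} where

    Above : Cops m k × Fin m → Cops n k × Fin n → Set
    Above (c , r) (d , q) = ∃ λ (F : Embedding) → (∀ i → d i ≡ at F (c i)) × q ≡ at F r

    Vacant : Cops m k → Fin n → Set
    Vacant c s = ∃ λ x → Twin G (ι x) s × ¬ Occupied c x

    -- The implication between the two occupations makes a vertex that is free in `G` free for its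
    -- representative in `H`.
    Enters : Cops m k → Cops n k → Fin n → Set
    Enters c d s = ∃ λ x → Twin G (ι x) s × (Occupied c x → Occupied d s) × Above (c , x) (d , s)

    above-twin : ∀ {c r d q} → Above (c , r) (d , q) → Twin G (ι r) q
    above-twin (F , _ , refl) = twin F _

    above-occupied : ∀ {c r d q} → Above (c , r) (d , q) → Occupied c r → Occupied d q
    above-occupied (F , d≡ , refl) (i , refl) = i , d≡ i

    above-cops : ∀ {c c′ r d q} {_⟶_ : Fin m → Fin m → Set} {_⟶′_ : Fin n → Fin n → Set} →
                 (∀ {u v x y} → Twin G (ι x) u → Twin G (ι y) v → (x ≡ y → u ≡ v) → x ⟶ y → u ⟶′ v) →
                 Above (c , r) (d , q) → (∀ i → c i ⟶ c′ i) → ∃ λ d′ → (∀ i → d i ⟶′ d′ i) × Above (c′ , r) (d′ , q)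
    above-cops {c} {c′} raise (F , d≡ , q≡) mv = at F ∘ c′ ,
      (λ i → raise (subst (Twin G (ι (c i))) (sym (d≡ i)) (twin F (c i))) (twin F (c′ i))
                   (λ eq → trans (d≡ i) (cong (at F) eq)) (mv i)) ,
      F , (λ _ → refl) , q≡

    -- If some representative `x` of the class of `s` carries no cop, moving the embedding at `x` to
    -- `s` displaces no cop. Thus the only obstruction is a reduced class all of whose
    -- representatives are occupied.
    enter : ∀ {c d} (F : Embedding) → (∀ i → d i ≡ at F (c i)) → ∀ s →
            Enters c d s ⊎ Reduced s × ¬ (∃ λ y → at F y ≡ s) × (∀ x → Twin G (ι x) s → Occupied c x)
    enter {c} {d} F d≡ s with any? (λ x → at F x Fin.≟ s)
    ... | yes (x , refl) = inj₁ (x , twin F x , (λ { (i , refl) → i , d≡ i }) , F , d≡ , refl)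
    ... | no s∉ with covers F s
    ...   | inj₁ s∈ = contradiction s∈ s∉
    ...   | inj₂ red with any? (λ x → twin? G (ι x) s ×-dec ¬? (occupied? c x))
    ...     | no full = inj₂ (red , s∉ , λ x tw → decidable-stable (occupied? c x) (λ ¬o → full (x , tw , ¬o)))
    ...     | yes (x , tw , ¬o) with relocate F x s∉ red tw
    ...       | F′ , at-x , at-y = inj₁ (x , tw , (λ o → contradiction o ¬o) , F′ ,
                (λ i → trans (d≡ i) (sym (at-y (c i) (λ eq → ¬o (i , eq))))) , sym at-x)

    module _ (vacant : ∀ {s} → Reduced s → (c : Cops m k) → Vacant c s) where

      enters : ∀ {c r d q} → Above (c , r) (d , q) → ∀ s → Enters c d s
      enters {c} (F , d≡ , _) s with enter F d≡ s
      ... | inj₁ e = e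
      ... | inj₂ (red , _ , full) = let x , tw , ¬o = vacant red c in contradiction (full x tw) ¬o

      above-active : Simulation (fullyActiveRules H k) (fullyActiveRules G k) Above
      above-active = record
        { goal       = λ p g → won (above-occupied p g)
        ; goal′      = λ p g → won (above-occupied p g)
        ; copMove    = above-cops (λ tu tv _ → raise-Adj E tu tv)
        ; mobile     = λ { (F , d≡ , refl) (s , a) → inj₂ (at F s , raise-Adj E (twin F _) (twin F s) a) }
        ; robberMove = λ {_} {_} {_} {_} {q′} p a → let x , tw , _ , p′ = enters p q′ in
                       inj₂ (x , lower-Adj E (above-twin p) tw a , p′)
        }

      above-fast : ∀ s → Simulation (fastRobberRules H k s) (fastRobberRules G k s) Above
      above-fast s = record
        { goal       = λ p g → won (above-occupied p g)
        ; goal′      = λ p g → won (above-occupied p g)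
        ; copMove    = above-cops raise-Refl′
        ; mobile     = λ { {d = d} {q} _ _ → stay-or-caught G s d q }
        ; robberMove = λ { p (w , _ , ≤s , free) → inj₂ (shadow p w ≤s free) }
        }
        where
        Free : ∀ {j l} → Cops l j → ∀ {G′ : Graph l} {u v} → Graph.Walk G′ u v → Set
        Free c {G′} w = All (λ v → ¬ Occupied c v) (Graph.vertices G′ w)

        -- Each inner vertex is replaced by a twin from `enters`, chosen independently of the
        -- others, and the embedding changed for it is discarded. Consecutive choices are adjacent
        -- because twins share their neighbours.
        project : ∀ {c r d q u v z x y} → Above (c , r) (d , q) → (a : G.Adj u v) (w : G.Walk v z) → Free d {G} w →
                  Twin G (ι x) u → ¬ Occupied c x → Twin G (ι y) z → ¬ Occupied c y →
                  ∃ λ (w′ : H.Walk x y) → H.edges w′ ≡ suc (G.edges w) × Free c {H} w′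
        project p a ε free tx ¬ox ty ¬oy = lower-Adj E tx ty a ◅ ε , refl , ¬ox ∷ ¬oy ∷ []
        project {v = v} p a (a′ ◅ w) (¬ov ∷ free) tx ¬ox ty ¬oy =
          let x′ , tx′ , occ , _ = enters p v
              w′ , len , free′ = project p a′ w free tx′ (¬ov ∘ occ) ty ¬oy
          in lower-Adj E tx tx′ a ◅ w′ , cong suc len , ¬ox ∷ free′

        target : ∀ {u v} (w : G.Walk u v) → v ∈ˡ G.vertices w
        target ε       = here refl
        target (_ ◅ w) = there (target w)

        shadow : ∀ {c r d q q′} → Above (c , r) (d , q) → (w : G.Walk q q′) → G.edges w ≤ s → Free d {G} w →
              ∃ λ r′ → Rules.RobberMove (fastRobberRules H k s) c r r′ × Above (c , r′) (d , q′)
        shadow p ε ≤s free@(¬o ∷ []) = _ , (ε , [] ∷ [] , z≤n , (¬o ∘ above-occupied p) ∷ []) , p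
        shadow {c} {q′ = q′} p w@(a ◅ w₁) ≤s free =
          let y , ty , occ , p′ = enters p q′
              w′ , len , free′ = project p a w₁ (All.tail free) (above-twin p) (All.head free ∘ above-occupied p) ty
                                   (All.lookup free (target w) ∘ occ)
              w″ , path , ≤len , free″ = shorten H w′ free′
          in y , (w″ , path , ≤-trans ≤len (≤-trans (≤-reflexive len) ≤s) , free″) , p′

      win-above : (R₁ : Rules m k) (R₂ : Rules n k) → Simulation R₁ R₂ Above → CopsWin R₁ → CopsWin R₂
      win-above R₁ R₂ sim (c , s) = ι ∘ c , start
        where
        start : ∀ q → CopsToMove R₂ (ι ∘ c) q
        start q with enter {c} initially (λ _ → refl) q
        ... | inj₁ (x , _ , _ , p) = Simulation.transfer sim p (s x)
        ... | inj₂ (red , _ , full) = let x , tw , ¬o = vacant red c in contradiction (full x tw) ¬o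

  -- `assign` says that a reduced class retains at least as many members as their degree: the
  -- neighbours of `s` inject into the representatives of its class. No relation to `k` is assumed.
  module _ {k : ℕ} (assign : ∀ {s} → Reduced s → ∃ λ (a : Fin n → Fin m) →
             (∀ {w} → G.Adj s w → Twin G (ι (a w)) s) ×
             (∀ {w w′} → G.Adj s w → G.Adj s w′ → a w ≡ a w′ → w ≡ w′)) where

    private
      RG : Rules n k
      RG = surroundingRules G k

    -- The cop on u w, a twin of s, moves to w.
    strike : ∀ {s} (e : Cops n k) (u : Fin n → Fin n) → (∀ {w} → G.Adj s w → Twin G (u w) s) →
             (∀ {w w′} → G.Adj s w → G.Adj s w′ → u w ≡ u w′ → w ≡ w′) → (∀ {w} → G.Adj s w → Occupied e (u w)) →
             ∃ λ e′ → (∀ i → ReflClosure G.Adj (e i) (e′ i)) × (∀ w → G.Adj s w → Occupied e′ w) ×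
                      (∀ i → e′ i ≡ e i ⊎ Twin G (e i) s)
    strike {s} e u tw inj occ = proj₁ ∘ target , proj₁ ∘ proj₂ ∘ target , reach , proj₁ ∘ proj₂ ∘ proj₂ ∘ target
      where
      target : ∀ i → ∃ λ v → ReflClosure G.Adj (e i) v × (v ≡ e i ⊎ Twin G (e i) s) × (∀ w → G.Adj s w → e i ≡ u w → v ≡ w)
      target i with any? (λ w → adjacent? G s w ×-dec (u w Fin.≟ e i))
      ... | yes (w , a , eq) = w , [ Twin-Adj G w (Twin-sym G (subst (λ v → Twin G v s) eq (tw a))) a ] ,
                               inj₂ (subst (λ v → Twin G v s) eq (tw a)) , λ w′ a′ eq′ → inj a a′ (trans eq eq′)
      ... | no ¬w = e i , stay , inj₁ refl , λ w a eq → contradiction (w , a , sym eq) ¬w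
      reach : ∀ w → G.Adj s w → Occupied (proj₁ ∘ target) w
      reach w a = let i , eq = occ a in i , proj₂ (proj₂ (proj₂ (target i))) w a eq

    Full : Cops m k → Fin n → Set
    Full c s = ∀ x → Twin G (ι x) s → Occupied c x

    module _ (F : Embedding) where

      strike-reduced : ∀ {s} (e : Cops n k) → Reduced s → (∀ x → Twin G (ι x) s → Occupied e (at F x)) →
        ∃ λ e′ → (∀ i → ReflClosure G.Adj (e i) (e′ i)) × (∀ w → G.Adj s w → Occupied e′ w) ×
               (∀ i → e′ i ≡ e i ⊎ Twin G (e i) s)
      strike-reduced e red full = let a , tw , inj = assign red in
        strike e (at F ∘ a) (λ {w} adj → Twin-trans G (Twin-sym G (twin F (a w))) (tw adj))
               (λ adj adj′ eq → inj adj adj′ (injective F eq)) (λ {w} adj → full (a w) (tw adj))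

      win-reduced : ∀ {s} (e : Cops n k) → Reduced s → (∀ x → Twin G (ι x) s → Occupied e (at F x)) → CopsToMove RG e s
      win-reduced e red full = let e′ , mv , all , _ = strike-reduced e red full in move e′ mv (won all)

      module _ {c : Cops m k} {d : Cops n k} (d≡ : ∀ i → d i ≡ at F (c i)) {r : Fin m}
               (surrounded : ∀ y → H.Adj r y → Occupied c y) where

        private
          q : Fin n
          q = at F r

          lift-occ : ∀ {x} → Occupied c x → Occupied d (at F x)
          lift-occ (i , refl) = i , d≡ i

          full : ∀ {s} → G.Adj q s → ∀ x → Twin G (ι x) s → Occupied d (at F x)
          full a x tw = lift-occ (surrounded x (lower-Adj E (twin F r) tw a))

          image-occupied : ∀ {s} → G.Adj q s → (∃ λ x → at F x ≡ s) → Occupied d s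
          image-occupied a (x , refl) = full a x (twin F x)

          reduced : ∀ {s} → G.Adj q s → ¬ Occupied d s → Reduced s
          reduced {s} a ¬o with covers F s
          ... | inj₁ s∈  = contradiction (image-occupied a s∈) ¬o
          ... | inj₂ red = red

        -- Not all neighbours of the robber need be occupied.  Then cops strike at an unoccupied one, v; this evicts the
        -- robber from q, and wherever it goes, it is surrounded at once or after another strike.
        surrounded-wins : CopsToMove RG d q
        surrounded-wins with surrounded-or-mobile G d q
        ... | inj₁ g            = won g
        ... | inj₂ (v , a , ¬o) = move e mv (evict (surrounded-or-mobile G e q))
          where
          st = strike-reduced d (reduced a ¬o) (full a)
          e  = proj₁ st
          mv = proj₁ (proj₂ st)
          all : ∀ w → G.Adj v w → Occupied e w
          all = proj₁ (proj₂ (proj₂ st))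
          moved : ∀ i → e i ≡ d i ⊎ Twin G (d i) v
          moved = proj₂ (proj₂ (proj₂ st))

          -- Only cops on twins of `v` took part in the strike, so the cops on any other class are
          -- still in place.
          still : ∀ {s x} → ¬ Twin G v s → Twin G (at F x) s → Occupied d (at F x) → Occupied e (at F x)
          still ¬tw tw (i , eq) with moved i
          ... | inj₁ e≡ = i , trans e≡ eq
          ... | inj₂ tv = contradiction (Twin-trans G (Twin-sym G (subst (λ u → Twin G u v) eq tv)) tw) ¬tw

          answer : ∀ s → ReflClosure G.Adj q s × ¬ Occupied e s → CopsToMove RG e s
          -- The robber's own vertex `q` is a neighbour of `v`, so the strike put a cop there.
          answer s (stay , ¬o′) = contradiction (all q (Adj-sym G a)) ¬o′
          answer s ([ a′ ] , ¬o′) with twin? G v s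
          -- A twin of `v` has the same neighbours, all of them occupied by the strike.
          ... | yes tw = won λ w aw → all w (Twin-Adj G w (Twin-sym G tw) aw)
          ... | no ¬tw with covers F s
          ...   | inj₁ (x , refl) = contradiction (still ¬tw (λ _ → refl) (full a′ x (twin F x))) ¬o′
          ...   | inj₂ red = win-reduced e red λ x tw → still ¬tw (Twin-trans G (Twin-sym G (twin F x)) tw) (full a′ x tw)

          evict : Rules.CopsGoal RG e q ⊎ (∃ λ s → G.Adj q s × ¬ Occupied e s) → RobberToMove RG e q
          evict (inj₁ g)             = won g
          evict (inj₂ (s , a′ , ¬o)) = reply (s , [ a′ ] , ¬o) answer

        -- Here the robber moves before any strike. If it stays, the cops are to move as before; an
        -- unoccupied neighbour of `q` lies in a reduced class whose members in the image are all
        -- occupied, so one strike surrounds the robber there.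
        surrounded-wins′ : RobberToMove RG d q
        surrounded-wins′ with surrounded-or-mobile G d q
        ... | inj₁ g             = won g
        ... | inj₂ (s , a , ¬o)  = reply (s , [ a ] , ¬o) λ where
          _ (stay , _)       → surrounded-wins
          s′ ([ a′ ] , ¬o′) → win-reduced d (reduced a′ ¬o′) (full a′)

    enter-full : ∀ {c d} (F : Embedding) → (∀ i → d i ≡ at F (c i)) →
                 ∀ {s} → Full c s → ∀ x → Twin G (ι x) s → Occupied d (at F x)
    enter-full F d≡ full x tw with full x tw
    ... | i , refl = i , d≡ i

    above-surrounding : Simulation (surroundingRules H k) RG Above
    above-surrounding = record
      { goal       = λ { (F , d≡ , refl) g → surrounded-wins F d≡ g }
      ; goal′      = λ { (F , d≡ , refl) g → surrounded-wins′ F d≡ g }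
      ; copMove    = above-cops raise-Refl′
      ; mobile     = λ { {d = d} {q} _ _ → Sum.map₂ (λ (v , a , ¬o) → v , [ a ] , ¬o) (surrounded-or-mobile G d q) }
      ; robberMove = robber
      }
      where
      robber : ∀ {c r d q q′} → Above (c , r) (d , q) → ReflClosure G.Adj q q′ × ¬ Occupied d q′ →
               CopsToMove RG d q′ ⊎ ∃ λ r′ → (ReflClosure H.Adj r r′ × ¬ Occupied c r′) × Above (c , r′) (d , q′)
      robber p (stay , ¬o) = inj₂ (_ , (stay , ¬o ∘ above-occupied p) , p)
      robber {q′ = q′} p@(F , d≡ , _) ([ a ] , ¬o) with enter F d≡ q′
      ... | inj₁ (x , tw , occ , p′) = inj₂ (x , ([ lower-Adj E (above-twin p) tw a ] , ¬o ∘ occ) , p′)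
      ... | inj₂ (red , _ , full)    = inj₁ (win-reduced F _ red (enter-full F d≡ full))

    win-above-surrounding : CopsWin (surroundingRules H k) → CopsWin RG
    win-above-surrounding (c , s) = ι ∘ c , start
      where
      start : ∀ q → CopsToMove RG (ι ∘ c) q
      start q with enter {c = c} initially (λ _ → refl) q
      ... | inj₁ (x , _ , _ , p)  = Simulation.transfer above-surrounding p (s x)
      ... | inj₂ (red , _ , full) = win-reduced initially _ red (enter-full {c = c} initially (λ _ → refl) full)

-- The kernels

module _ {n : ℕ} (G : Graph n) (t : Fin n → ℕ) (t-cong : ∀ {u v} → Twin G u v → t u ≡ t v) where

  keptRetract : Retract G (induced G (kept G t))
  keptRetract = record { ι = emb G t t-cong ; π = ret G t t-cong ; πι = ret-emb G t t-cong ; ιπ = emb-ret G t t-cong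
                       ; adjacent-ι = λ _ _ → refl }

  Crowded : Fin n → Set
  Crowded v = ∃ λ (b : Fin (suc (t v)) → Fin (length (kept G t))) →
    Injective _≡_ _≡_ b × (∀ j → Twin G (emb G t t-cong (b j)) v)

  Crowded-Twin : ∀ {u v} → Twin G u v → Crowded u → Crowded v
  Crowded-Twin {u} {v} tw crowded with t u | t-cong tw
  Crowded-Twin {u} {v} tw (b , inj , twb) | _ | refl = b , inj , λ j → Twin-trans G (twb j) tw

module _ {n k : ℕ} (G : Graph n) where
  open Graph G

  private
    t : Fin n → ℕ
    t _ = k
    E = keptRetract G t (λ _ → refl)
    H = induced G (kept G t)

  -- Pigeonhole: `k` cops cannot occupy `k + 1` kept twins.
  vacant : ∀ {v} → Crowded G t (λ _ → refl) v → (c : Cops (length (kept G t)) k) →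
           ∃ λ x → Twin G (Retract.ι E x) v × ¬ Occupied c x
  vacant (b , inj , tw) c with any? (λ j → ¬? (occupied? c (b j)))
  ... | yes (j , ¬o) = b j , tw j , ¬o
  ... | no all-occupied = contradiction (injective⇒≤ {f = proj₁ ∘ cop} λ {i} {j} eq →
          inj (trans (sym (proj₂ (cop i))) (trans (cong c eq) (proj₂ (cop j))))) 1+n≰n
    where
    cop : ∀ j → Occupied c (b j)
    cop j = decidable-stable (occupied? c (b j)) (λ ¬o → all-occupied (j , ¬o))

  active-reduction : CopsWin (fullyActiveRules G k) ⇔ CopsWin (fullyActiveRules H k)
  active-reduction = mk⇔ (win-below E _ _ (below-active E))
    (win-above E (Crowded-Twin G t λ _ → refl) (kept-or-many G t λ _ → refl) vacant _ _
      (above-active E (Crowded-Twin G t λ _ → refl) (kept-or-many G t λ _ → refl) vacant))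

  fast-reduction : ∀ s → CopsWin (fastRobberRules G k s) ⇔ CopsWin (fastRobberRules H k s)
  fast-reduction s = mk⇔ (win-below E _ _ (below-fast E s))
    (win-above E (Crowded-Twin G t λ _ → refl) (kept-or-many G t λ _ → refl) vacant _ _
      (above-fast E (Crowded-Twin G t λ _ → refl) (kept-or-many G t λ _ → refl) vacant s))

module _ {n : ℕ} (G : Graph n) where
  open Graph G

  -- Truncated only at isolated vertices, hence only in the connected graph with one vertex.
  pred-degree : Fin n → ℕ
  pred-degree v = length (neighbours G v) ∸ 1

  pred-degree-cong : ∀ {u v} → Twin G u v → pred-degree u ≡ pred-degree v
  pred-degree-cong tw = cong (λ ws → length ws ∸ 1) (neighbours-cong G tw)

  private
    E = keptRetract G pred-degree pred-degree-cong
    H = induced G (kept G pred-degree)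

  -- A crowded class keeps `suc (pred-degree v)` members, at least one for each neighbour of `v`.
  -- Vertices that are not neighbours all get slot zero, as injectivity is claimed on neighbours
  -- only.
  slots : ∀ {v} → Crowded G pred-degree pred-degree-cong v → ∃ λ (a : Fin n → Fin (length (kept G pred-degree))) →
           (∀ {w} → Adj v w → Twin G (Retract.ι E (a w)) v) × (∀ {w w′} → Adj v w → Adj v w′ → a w ≡ a w′ → w ≡ w′)
  slots {v} (b , inj , tw) = b ∘ slot , (λ {w} _ → tw (slot w)) , λ a a′ eq → slot-injective a a′ (inj eq)
    where
    fits : length (neighbours G v) ≤ suc (length (neighbours G v) ∸ 1)
    fits = m≤n+m∸n (length (neighbours G v)) 1
    slot : Fin n → Fin (suc (length (neighbours G v) ∸ 1))
    slot w with Any.any? (w Fin.≟_) (neighbours G v)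
    ... | yes w∈ = inject≤ (Any.index w∈) fits
    ... | no _   = Fin.zero
    slot-injective : ∀ {w w′} → Adj v w → Adj v w′ → slot w ≡ slot w′ → w ≡ w′
    slot-injective {w} {w′} a a′ eq with Any.any? (w Fin.≟_) (neighbours G v) | Any.any? (w′ Fin.≟_) (neighbours G v)
    ... | no w∉  | _       = contradiction (∈-neighbours⁺ G a) w∉
    ... | yes _  | no w∉   = contradiction (∈-neighbours⁺ G a′) w∉
    ... | yes w∈ | yes w′∈ = trans (lookup-index w∈) (trans
            (cong (lookup (neighbours G v)) (inject≤-injective fits fits (Any.index w∈) (Any.index w′∈) eq))
            (sym (lookup-index w′∈)))

module _ {n k : ℕ} (G : Graph n) where
  private
    E = keptRetract G (pred-degree G) (pred-degree-cong G)
    H = induced G (kept G (pred-degree G))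

  surrounding-above : CopsWin (surroundingRules H k) → CopsWin (surroundingRules G k)
  surrounding-above = win-above-surrounding E (Crowded-Twin G (pred-degree G) (pred-degree-cong G))
    (kept-or-many G (pred-degree G) (pred-degree-cong G)) (slots G)

  surrounding-reduction : CopsWin (surroundingRules G k) ⇔ CopsWin (surroundingRules H k)
  surrounding-reduction = mk⇔ (win-below E _ _ (below-surrounding E)) surrounding-above

-- One cop makes the capture while the others make any legal move. In the fully active game they may
-- not stay, and `next` supplies their moves.
catch : ∀ {n k} {_⟶_ : Fin n → Fin n → Set} → (∀ v → ∃ (v ⟶_)) → ∀ (c : Cops n k) {i r} → c i ⟶ r →
        ∃ λ c′ → (∀ j → c j ⟶ c′ j) × c′ i ≡ r
catch {_⟶_ = _⟶_} next c {i} {r} cᵢ⟶r = proj₁ ∘ target , proj₁ ∘ proj₂ ∘ target , proj₂ (proj₂ (target i)) refl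
  where
  target : ∀ j → ∃ λ v → c j ⟶ v × (j ≡ i → v ≡ r)
  target j with j Fin.≟ i
  ... | yes refl = r , cᵢ⟶r , λ _ → refl
  ... | no j≢i   = let v , cⱼ⟶v = next (c j) in v , cⱼ⟶v , λ j≡i → contradiction j≡i j≢i

module _ {n k : ℕ} (G : Graph n) {c : Fin k → Fin n} (dom : ∀ v → ∃ λ i → c i ≡ v ⊎ Graph.Adj G (c i) v) where

  dominating-wins-active : (∀ v → ∃ (Graph.Adj G v)) → CopsWin (fullyActiveRules G k)
  dominating-wins-active nbr = c , start
    where
    start : ∀ r → CopsToMove (fullyActiveRules G k) c r
    start r with dom r
    ... | i , inj₁ eq = won (i , eq)
    ... | i , inj₂ a  = let c′ , mv , eq = catch nbr c a in move c′ mv (won (i , eq))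

  dominating-wins-fast : ∀ s → CopsWin (fastRobberRules G k s)
  dominating-wins-fast s = c , start
    where
    start : ∀ r → CopsToMove (fastRobberRules G k s) c r
    start r with dom r
    ... | i , inj₁ eq = won (i , eq)
    ... | i , inj₂ a  = let c′ , mv , eq = catch {_⟶_ = ReflClosure (Graph.Adj G)} (λ v → v , stay) c [ a ]
                        in move c′ mv (won (i , eq))

module _ {n : ℕ} (R : Rules n 0) (uncaught : ∀ {c r} → ¬ Rules.CopsGoal R c r) where
  mutual
    -- Each `reply` contains at least one robber move, so a strategy without captures would have an
    -- infinite branch, which a well-founded tree excludes.
    ¬cops : ∀ {c r} → ¬ CopsToMove R c r
    ¬cops (won g)      = uncaught g
    ¬cops (move _ _ s) = ¬robber s
    ¬robber : ∀ {c r} → ¬ RobberToMove R c r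
    ¬robber (won g)              = uncaught g
    ¬robber (reply (r′ , mv) s) = ¬cops (s r′ mv)

-- In all three games these are constant instances: without vertices, zero cops win and one cop cannot be placed.
emptyInstance : ℕ → Instance
emptyInstance k = record
  { order = 0 ; graph = record { adjacent = λ () ; symmetric = λ () ; irreflexive = λ () }
  ; connected = λ () ; cops = k }

no-win-without-vertices : ∀ {k} (R : Rules 0 (suc k)) → ¬ CopsWin R
no-win-without-vertices R (c , _) with () ← c Fin.zero

win-without-vertices : (R : Rules 0 0) → CopsWin R
win-without-vertices R = (λ ()) , λ ()

reducedInstance : (I : Instance) (t : Fin (order I) → ℕ) → (∀ {u v} → Twin (graph I) u v → t u ≡ t v) → Instance
reducedInstance I t t-cong = record
  { order = length (kept (graph I) t) ; graph = induced (graph I) (kept (graph I) t)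
  ; connected = kept-connected (graph I) t t-cong (connected I) ; cops = cops I }

-- The two ways to lose the capture games outright: cops that cannot be placed, or a robber and no
-- cops.
mismatch? : ∀ n k → Dec (n ≤ 0 × 1 ≤ k ⊎ 1 ≤ n × ¬ (1 ≤ k))
mismatch? n k = ((n ≤? 0) ×-dec (1 ≤? k)) ⊎-dec ((1 ≤? n) ×-dec ¬? (1 ≤? k))

-- The number of stars, when no vertex is isolated: a forest has as many components as vertices
-- minus edges.
centres : Instance → ℕ
centres I = order I ∸ length (edgeCover (graph I))

captureKernel : Instance → Instance
captureKernel I = if does (mismatch? (order I) (cops I)) then emptyInstance 1 else
                  if does (centres I ≤? cops I) then emptyInstance 0 else
                  reducedInstance I (λ _ → cops I) (λ _ → refl)

-- If the cops can occupy every vertex of the reduced graph, they win there at once, and hence in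
-- the original graph. Otherwise its order bounds their number. Orders up to one are split off so
-- that the remaining degrees are positive.
surroundingKernel : Instance → Instance
surroundingKernel I =
  if does ((order I ≤? 0) ×-dec (1 ≤? cops I)) then emptyInstance 1 else
  if does ((order I ≤? 1) ⊎-dec (length (kept (graph I) (pred-degree (graph I))) ≤? cops I)) then emptyInstance 0 else
  reducedInstance I (pred-degree (graph I)) (pred-degree-cong (graph I))

surroundingKernel-cases : (Q : Instance → Set) (I : Instance) →
  let n = order I ; m = length (kept (graph I) (pred-degree (graph I))) in
  (n ≤ 0 × 1 ≤ cops I → Q (emptyInstance 1)) →
  (¬ (n ≤ 0 × 1 ≤ cops I) → n ≤ 1 ⊎ m ≤ cops I → Q (emptyInstance 0)) →
  (¬ (n ≤ 1 ⊎ m ≤ cops I) → Q (reducedInstance I (pred-degree (graph I)) (pred-degree-cong (graph I)))) →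
  Q (surroundingKernel I)
surroundingKernel-cases Q I q₁ q₂ q₃ = if-dec Q ((order I ≤? 0) ×-dec (1 ≤? cops I)) q₁ λ ¬p →
  if-dec Q ((order I ≤? 1) ⊎-dec (length (kept (graph I) (pred-degree (graph I))) ≤? cops I)) (q₂ ¬p) q₃

module _ {Γ : Set} {e : Γ → Tree} {I : Γ → Instance} (cI : Computes e (λ _ → encode) I) where

  orderC : Computes e (λ _ → unary) (λ γ → order (I γ))
  orderC = recode (λ γ → cong unary (length-tabulate {n = order (I γ)} id)) (lengthC (allFinC cI))

  copsC : Computes e (λ _ → encodeBool) (λ γ → does (1 ≤? cops (I γ)))
  copsC = ≤?-copsC cI (unaryC 1)

  emptyC₀ : Computes e (λ _ → encode) (λ _ → emptyInstance 0)
  emptyC₀ = recode (λ _ → refl) (expC (cons nil nil))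
  emptyC₁ : Computes e (λ _ → encode) (λ _ → emptyInstance 1)
  emptyC₁ = recode (λ _ → refl) (expC (cons nil (cons nil nil)))

captureKernelC : Computes encode (λ _ → encode) captureKernel
captureKernelC = ifC (orC (andC (≤?-C (orderC I) (unaryC 0)) (copsC I)) (andC (≤?-C (unaryC 1) (orderC I)) (notC (copsC I))))
  (emptyC₁ I)
  (ifC (≤?-copsC I (monusC (orderC I) (lengthC (edgeCoverC I)))) (emptyC₀ I)
    (inducedC I (keptC (λ I _ → cops I) (λ cI _ cxs → dropCopsC cI cxs) I)
      (λ I → kept-connected (graph I) (λ _ → cops I) (λ _ → refl) (connected I))))
  where
  I : Computes encode (λ _ → encode) id
  I = recode (λ _ → refl) (expC X)

surroundingKernelC : Computes encode (λ _ → encode) surroundingKernel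
surroundingKernelC = ifC (andC (≤?-C (orderC I) (unaryC 0)) (copsC I)) (emptyC₁ I)
  (ifC (orC (≤?-C (orderC I) (unaryC 1)) (≤?-copsC I (lengthC kC))) (emptyC₀ I)
    (inducedC I kC (λ I → kept-connected (graph I) (pred-degree (graph I)) (pred-degree-cong (graph I)) (connected I))))
  where
  I : Computes encode (λ _ → encode) id
  I = recode (λ _ → refl) (expC X)
  kC : Computes encode (λ _ → encL encV) (λ I → kept (graph I) (pred-degree (graph I)))
  kC = keptC (λ I → pred-degree (graph I)) (λ cI cv cxs → dropC (monusC (lengthC (neighboursC cI cv)) (unaryC 1)) cxs) I

-- Size bounds and correctness of the kernels

size-encodeList-tabulate : ∀ {n} s (f : Fin n → Tree) → (∀ i → size (f i) ≤ s) →
                           size (encodeList (tabulate f)) ≤ 1 + n * (1 + s)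
size-encodeList-tabulate {zero} s f f≤  = ≤-refl
size-encodeList-tabulate {suc n} s f f≤ = s≤s (≤-trans
  (+-mono-≤ (f≤ Fin.zero) (size-encodeList-tabulate s (f ∘ Fin.suc) (f≤ ∘ Fin.suc))) (≤-reflexive (+-suc s (n * suc s))))

size-encodeBool : ∀ b → size (encodeBool b) ≤ 3
size-encodeBool true  = ≤-refl
size-encodeBool false = s≤s z≤n

size-encodeBinary : ∀ b → size (encodeBinary b) ≤ 1 + 4 * Bin.toℕ b
size-encodeBinary ℕᵇ.zero  = ≤-refl
size-encodeBinary 2[1+ b ] = s≤s (≤-trans (+-monoʳ-≤ 3 (size-encodeBinary b))
  (≤-trans (≤-reflexive (sym (*-suc 4 (Bin.toℕ b)))) (*-monoʳ-≤ 4 (m≤m+n (suc (Bin.toℕ b)) _))))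
size-encodeBinary 1+[2 b ] = s≤s (≤-trans (+-monoʳ-≤ 1 (size-encodeBinary b))
  (≤-trans (m≤n+m (2 + 4 * Bin.toℕ b) 2)
  (≤-trans (≤-reflexive (sym (*-suc 4 (Bin.toℕ b)))) (*-monoʳ-≤ 4 (s≤s (m≤m+n (Bin.toℕ b) _))))))

sizeOf : ℕ → ℕ → ℕ
sizeOf a b = 1 + ((1 + a * (1 + (1 + a * (1 + 3)))) + (1 + 4 * b))

instanceSize≤ : ∀ I {a b} → order I ≤ a → cops I ≤ b → instanceSize I ≤ sizeOf a b
instanceSize≤ I {a} {b} n≤a k≤b = s≤s (+-mono-≤
  (≤-trans (size-encodeList-tabulate (1 + a * (1 + 3)) (encodeRow I) λ u → ≤-trans
      (size-encodeList-tabulate 3 _ (λ v → size-encodeBool (Graph.adjacent (graph I) u v))) (s≤s (*-monoˡ-≤ (1 + 3) n≤a)))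
    (s≤s (*-monoˡ-≤ _ n≤a)))
  (≤-trans (size-encodeBinary (fromℕ (cops I))) (s≤s (*-monoʳ-≤ 4 (≤-trans (≤-reflexive (toℕ-fromℕ (cops I))) k≤b)))))

-- The cops are bounded because their number is part of the instance size. The `suc` admits the
-- single cop of `emptyInstance 1` when `p` is zero.
Small : ℕ → Instance → Set
Small p J = order J ≤ p + p * 2 ^ p × cops J ≤ suc (p + p * 2 ^ p)

kernelWithAtMost : ∀ {P : Problem} (f : Instance → Instance) → Computes encode (λ _ → encode) f → (∀ I → P I ⇔ P (f I)) →
                   (∀ I U → Graph.IsVertexCover (graph I) U → Small ∣ U ∣ (f I)) → KernelWithAtMost (λ p → p + p * 2 ^ p) vcn P
kernelWithAtMost f fC equiv small = record
  { kernel         = f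
  ; polynomialTime = polynomialTime-encode fC
  ; equivalent     = equiv
  ; sizeBound      = (λ p → sizeOf (p + p * 2 ^ p) (suc (p + p * 2 ^ p))) ,
                     λ { I _ ((U , cover , refl) , _) → instanceSize≤ (f I) (proj₁ (small I U cover)) (proj₂ (small I U cover)) }
  ; orderBound     = λ { I _ ((U , cover , refl) , _) → proj₁ (small I U cover) }
  }

both : {A B : Set} → A → B → A ⇔ B
both a b = mk⇔ (λ _ → b) (λ _ → a)

neither : {A B : Set} → ¬ A → ¬ B → A ⇔ B
neither ¬a ¬b = mk⇔ (λ a → contradiction a ¬a) (λ b → contradiction b ¬b)

small-empty : ∀ p {k} → k ≤ 1 → Small p (emptyInstance k)
small-empty p k≤1 = z≤n , ≤-trans k≤1 (s≤s z≤n)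

captureKernel-small : ∀ I U → Graph.IsVertexCover (graph I) U → Small ∣ U ∣ (captureKernel I)
captureKernel-small I U cover = if-dec (Small p) (mismatch? n k) (λ _ → small-empty p ≤-refl) λ match →
  if-dec (Small p) (centres I ≤? k) (λ _ → small-empty p z≤n) λ few → reduced match (≰⇒> few)
  where
  n = order I
  k = cops I
  p = ∣ U ∣
  reduced : ¬ (n ≤ 0 × 1 ≤ k ⊎ 1 ≤ n × ¬ (1 ≤ k)) → k < centres I → Small p (reducedInstance I (λ _ → k) (λ _ → refl))
  reduced match k< = kept-bound (graph I) (λ _ → k) (λ _ → refl) U cover (λ _ _ → k<p) ,
    m≤n⇒m≤1+n (<⇒≤ (≤-trans k<p (m≤m+n p (p * 2 ^ p))))
    where
    k<n : k < n
    k<n = ≤-trans k< (m∸n≤m n (length (edgeCover (graph I))))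
    -- With `k < n` this gives two vertices, so connectedness excludes isolated vertices and the
    -- star forest exists.
    1≤k : 1 ≤ k
    1≤k = decidable-stable (1 ≤? k) (λ k≱1 → match (inj₂ (≤-trans (s≤s z≤n) k<n , k≱1)))
    k<p : k < p
    k<p = ≤-trans k< (centres≤cover (graph I)
      (starForest (graph I) (nbr-of-connected (graph I) (connected I) (≤-trans (s≤s 1≤k) k<n))) U cover)

all-one : ∀ {n} → n ≤ 1 → (u v : Fin n) → u ≡ v
all-one _ Fin.zero Fin.zero = refl
all-one (s≤s ()) Fin.zero (Fin.suc Fin.zero)
all-one (s≤s ()) (Fin.suc Fin.zero) _

module _ (P : Problem) where

  -- What the fully active and the fast game share. The dominated case is given neighbours for all
  -- vertices because fully active cops must move even when only one of them captures.
  captureKernel-equivalent :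
    (∀ I → order I ≡ 0 → 1 ≤ cops I → ¬ P I) → (∀ I → order I ≡ 0 → cops I ≡ 0 → P I) →
    (∀ I → 1 ≤ order I → cops I ≡ 0 → ¬ P I) →
    (∀ I → 1 ≤ cops I → (2 ≤ order I → ∀ v → ∃ (Graph.Adj (graph I) v)) →
       (∃ λ (c : Fin (cops I) → Fin (order I)) → ∀ v → ∃ λ i → c i ≡ v ⊎ Graph.Adj (graph I) (c i) v) → P I) →
    (∀ I → P I ⇔ P (reducedInstance I (λ _ → cops I) (λ _ → refl))) →
    ∀ I → P I ⇔ P (captureKernel I)
  captureKernel-equivalent no-vertices no-cops-needed no-cops dominated reduction I =
    if-dec (λ J → P I ⇔ P J) (mismatch? n k) (λ mis →
      neither (mismatched mis) (no-vertices (emptyInstance 1) refl ≤-refl)) λ match →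
    if-dec (λ J → P I ⇔ P J) (centres I ≤? k) (λ few →
      both (enough few match) (no-cops-needed (emptyInstance 0) refl refl)) λ _ → reduction I
    where
    n = order I
    k = cops I
    mismatched : n ≤ 0 × 1 ≤ k ⊎ 1 ≤ n × ¬ (1 ≤ k) → ¬ P I
    mismatched (inj₁ (n≤0 , 1≤k)) = no-vertices I (n≤0⇒n≡0 n≤0) 1≤k
    mismatched (inj₂ (1≤n , k≱1)) = no-cops I 1≤n (n<1⇒n≡0 (≰⇒> k≱1))

    nbr : 2 ≤ n → ∀ v → ∃ (Graph.Adj (graph I) v)
    nbr = nbr-of-connected (graph I) (connected I)

    enough : centres I ≤ k → ¬ (n ≤ 0 × 1 ≤ k ⊎ 1 ≤ n × ¬ (1 ≤ k)) → P I
    enough few match with 1 ≤? n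
    ... | no n≱1 = no-cops-needed I (n<1⇒n≡0 (≰⇒> n≱1)) (n<1⇒n≡0 (≰⇒> λ 1≤k → match (inj₁ (≮⇒≥ n≱1 , 1≤k))))
    ... | yes 1≤n = dominated I 1≤k nbr dominating
      where
      1≤k = decidable-stable (1 ≤? k) (λ k≱1 → match (inj₂ (1≤n , k≱1)))
      dominating : ∃ λ (c : Fin k → Fin n) → ∀ v → ∃ λ i → c i ≡ v ⊎ Graph.Adj (graph I) (c i) v
      dominating with 2 ≤? n
      ... | yes 2≤n = centres-dominate (graph I) (starForest (graph I) (nbr 2≤n)) few (Fin.fromℕ< 1≤n)
      ... | no n≱2  = (λ _ → Fin.fromℕ< 1≤n) , λ v → Fin.fromℕ< 1≤k , inj₁ (all-one (≤-pred (≰⇒> n≱2)) _ v)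

active-equivalent : ∀ I → FullyActiveCopsAndRobber I ⇔ FullyActiveCopsAndRobber (captureKernel I)
active-equivalent = captureKernel-equivalent FullyActiveCopsAndRobber
  (λ { record { order = 0 ; graph = G ; cops = suc k } refl _ → no-win-without-vertices (fullyActiveRules G (suc k)) })
  (λ { record { order = 0 ; graph = G ; cops = 0 } refl refl → win-without-vertices (fullyActiveRules G 0) })
  (λ { record { order = suc n ; graph = G ; cops = 0 } _ refl (c , s) → ¬cops (fullyActiveRules G 0) (λ ()) (s Fin.zero) })
  dominated (λ I → active-reduction (graph I))
  where
  dominated : ∀ I → 1 ≤ cops I → (2 ≤ order I → ∀ v → ∃ (Graph.Adj (graph I) v)) →
              (∃ λ (c : Fin (cops I) → Fin (order I)) → ∀ v → ∃ λ i → c i ≡ v ⊎ Graph.Adj (graph I) (c i) v) →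
              FullyActiveCopsAndRobber I
  dominated I 1≤k nbr (c , dom) with 2 ≤? order I
  ... | yes 2≤n = dominating-wins-active (graph I) dom (nbr 2≤n)
  -- On a single vertex no active move exists, but the robber is caught as soon as it is placed.
  ... | no n≱2  = c , λ r → won (Fin.fromℕ< 1≤k , all-one (≤-pred (≰⇒> n≱2)) _ r)

fast-equivalent : ∀ s I → CopsAndFastRobber s I ⇔ CopsAndFastRobber s (captureKernel I)
fast-equivalent s = captureKernel-equivalent (CopsAndFastRobber s)
  (λ { record { order = 0 ; graph = G ; cops = suc k } refl _ → no-win-without-vertices (fastRobberRules G (suc k) s) })
  (λ { record { order = 0 ; graph = G ; cops = 0 } refl refl → win-without-vertices (fastRobberRules G 0 s) })
  (λ { record { order = suc n ; graph = G ; cops = 0 } _ refl (c , s′) → ¬cops (fastRobberRules G 0 s) (λ ()) (s′ Fin.zero) })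
  (λ I _ _ (c , dom) → dominating-wins-fast (graph I) dom s) (λ I → fast-reduction (graph I) s)

surrounding-win-everywhere : ∀ {n k} (G : Graph n) → n ≤ k → Fin n → CopsWin (surroundingRules G k)
surrounding-win-everywhere {n} G n≤k v₀ with spread (allFin n) (≤-trans (≤-reflexive (length-tabulate id)) n≤k) v₀
... | c , hit = c , λ r → won λ v _ → hit (∈-allFin v)

surrounding-win-one : ∀ {n k} (G : Graph n) → n ≤ 1 → Fin n → CopsWin (surroundingRules G k)
surrounding-win-one G n≤1 v₀ = (λ _ → v₀) , λ r → won λ v a →
  contradiction (subst (Graph.Adj G r) (all-one n≤1 v r) a) (Adj-irrefl G {r})

surrounding-equivalent : ∀ I → SurroundingCopsAndRobber I ⇔ SurroundingCopsAndRobber (surroundingKernel I)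
surrounding-equivalent I = surroundingKernel-cases (λ J → P I ⇔ P J) I
  (λ (n≤0 , 1≤k) → neither (no-vertices n≤0 1≤k) (no-win-without-vertices (surroundingRules (graph (emptyInstance 1)) 1)))
  (λ match easy → both (easy-win match easy) (win-without-vertices (surroundingRules (graph (emptyInstance 0)) 0)))
  (λ _ → surrounding-reduction G)
  where
  P = SurroundingCopsAndRobber
  n = order I
  k = cops I
  G = graph I
  m = length (kept G (pred-degree G))

  no-vertices : n ≤ 0 → 1 ≤ k → ¬ P I
  no-vertices n≤0 1≤k (c , _) with () ← subst Fin (n≤0⇒n≡0 n≤0) (c (Fin.fromℕ< 1≤k))

  easy-win : ¬ (n ≤ 0 × 1 ≤ k) → n ≤ 1 ⊎ m ≤ k → P I
  easy-win match easy with 1 ≤? n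
  ... | no n≱1 = (λ i → contradiction (≮⇒≥ n≱1 , ≤-trans (s≤s z≤n) (toℕ<n i)) match) ,
                 λ r → contradiction (≤-trans (s≤s z≤n) (toℕ<n r)) n≱1
  ... | yes 1≤n with easy
  ...   | inj₁ n≤1 = surrounding-win-one G n≤1 (Fin.fromℕ< 1≤n)
  ...   | inj₂ m≤k = surrounding-above G (surrounding-win-everywhere (induced G (kept G (pred-degree G))) m≤k
                       (ret G (pred-degree G) (pred-degree-cong G) (Fin.fromℕ< 1≤n)))

surroundingKernel-small : ∀ I U → Graph.IsVertexCover (graph I) U → Small ∣ U ∣ (surroundingKernel I)
surroundingKernel-small I U cover = surroundingKernel-cases (Small p) I
  (λ _ → small-empty p ≤-refl) (λ _ _ → small-empty p z≤n) λ hard →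
  m≤ (≰⇒> (hard ∘ inj₁)) , ≤-trans (<⇒≤ (≰⇒> (hard ∘ inj₂))) (m≤n⇒m≤1+n (m≤ (≰⇒> (hard ∘ inj₁))))
  where
  n = order I
  k = cops I
  G = graph I
  m = length (kept G (pred-degree G))
  p = ∣ U ∣
  m≤ : 2 ≤ n → m ≤ p + p * 2 ^ p
  m≤ 2≤n = kept-bound G (pred-degree G) (pred-degree-cong G) U cover λ v v∉ →
    -- With two vertices and connectedness the degree is positive, so that the successor of
    -- `pred-degree` is the degree itself.
    subst (_≤ p) (sym (m+[n∸m]≡n (∈-length (∈-neighbours⁺ G (proj₂ (nbr-of-connected G (connected I) 2≤n v))))))
          (degree-bound G U cover v v∉)

theorem10 : KernelWithAtMost (λ p → p + p * 2 ^ p) vcn FullyActiveCopsAndRobber ×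
    (∀ (s : ℕ) → KernelWithAtMost (λ p → p + p * 2 ^ p) vcn (CopsAndFastRobber s)) ×
    KernelWithAtMost (λ p → p + p * 2 ^ p) vcn SurroundingCopsAndRobber
theorem10 = kernelWithAtMost captureKernel captureKernelC active-equivalent captureKernel-small ,
            (λ s → kernelWithAtMost captureKernel captureKernelC (fast-equivalent s) captureKernel-small) ,
            kernelWithAtMost surroundingKernel surroundingKernelC surrounding-equivalent surroundingKernel-small
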